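{- Let $n,t$ be integers with $0\le t\le n-4$, and let $\mathcal{E}(n,t)$ be the set of trees of order $n$ with exactly $t$ vertices of degree two. If $T\in\mathcal{E}(n,t)$ has maximum Mostar index among all trees in $\mathcal{E}(n,t)$, then $T\cong S_{n,n-t-1}$.
   Context: For a connected simple graph $G$, the Mostar index is $Mo(G)=\sum_{uv\in E(G)}|n_u-n_v|$, where for an edge $e=uv$, $n_u$ is the number of vertices of $G$ closer (in graph distance) to $u$ than to $v$, and $n_v$ is the number of vertices closer to $v$ than to $u$. The order of a graph is its number of vertices. For $3\le r\le n-2$, $S_{n,r}$ is the $n$-vertex tree consisting of $r$ pendent paths attached at a common vertex (i.e. a spider with $r$ legs), of which $s$ have length $\lfloor\frac{n-1}{r}\rfloor+1$ and $r-s$ have length $\lfloor\frac{n-1}{r}\rfloor$, where $s=n-1-r\lfloor\frac{n-1}{r}\rfloor$ (length = number of edges). Also $S_{n,n-1}=S_n$, the star on $n$ vertices, and $S_{n,2}=P_n$, the path on $n$ vertices. -}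

module Defs where

open import Level using (0ℓ)
open import Data.Bool.Base using (if_then_else_)
open import Data.Empty using (⊥-elim)
open import Data.Fin.Base as Fin using (Fin; toℕ)
open import Data.Fin.Properties as Fin using (any?)
open import Data.List.Base using (List; []; _∷_; allFin; cartesianProduct; filter; length; map)
open import Data.List.Relation.Unary.Unique.Propositional using (Unique)
open import Data.Nat.Base
  using (ℕ; zero; suc; _+_; _*_; _∸_; _/_; _≤_; _<_; z≤n; s≤s; ∣_-_∣; NonZero; >-nonZero)
open import Data.Nat.ListAction using (sum)
open import Data.Nat.Properties as ℕ using (_≟_; _<?_; m<n⇒0<n∸m; ∸-+-assoc; +-monoʳ-≤; ≤-trans)
open import Data.Product.Base using (∃-syntax; _×_; _,_; proj₁)
open import Data.Sum.Base using (_⊎_; inj₁; inj₂; swap)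
open import Function.Base using (_∘_)
open import Function.Bundles using (_↔_; _⇔_; Inverse)
open import Relation.Binary.Core using (Rel)
open import Relation.Binary.Definitions using (Decidable; Symmetric)
open import Relation.Binary.PropositionalEquality.Core using (_≡_; refl; sym; subst)
open import Relation.Nullary using (¬_; Dec; yes; no; does)
open import Relation.Nullary.Decidable using (map′; _×-dec_; _⊎-dec_)
open import Relation.Unary using (Pred) renaming (Decidable to Decidable₁)

-- Decidability of adjacency is automatic classically; constructively it
-- is what makes degrees and distances natural numbers.
record SimpleGraph (V : Set) : Set₁ where
  infix 4 _~_ _~?_
  field
    _~_      : Rel V 0ℓ
    _~?_     : Decidable _~_
    ~-sym    : Symmetric _~_
    ~-irrefl : ∀ {v} → ¬ (v ~ v)

record _≅_ {V W : Set} (G : SimpleGraph V) (H : SimpleGraph W) : Set where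
  private
    module G = SimpleGraph G
    module H = SimpleGraph H
  field
    vertices : V ↔ W
  open Inverse vertices using (to) public
  field
    adjacency : ∀ u v → (u G.~ v) ⇔ (to u H.~ to v)

infix 4 _≅_

module _ {V : Set} (G : SimpleGraph V) where
  open SimpleGraph G

  -- Walk k u v: walks from u to v with k edges.
  data Walk : ℕ → V → V → Set where
    stop : ∀ {u} → Walk 0 u u
    step : ∀ {k u w v} → u ~ w → Walk k w v → Walk (suc k) u v

  walkVertices : ∀ {k u v} → Walk k u v → List V
  walkVertices {u = u} stop       = u ∷ []
  walkVertices {u = u} (step _ p) = u ∷ walkVertices p

  Connected : Set
  Connected = ∀ u v → ∃[ k ] Walk k u v

  -- A path with at least two edges together with an edge joining its ends.
  record Cycle : Set where
    field
      {len}       : ℕ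
      {start end} : V
      path        : Walk (2 + len) start end
      distinct    : Unique (walkVertices path)
      closing     : end ~ start

  record IsTree : Set where
    field
      connected : Connected
      acyclic   : ¬ Cycle

least : {P : Pred ℕ 0ℓ} → Decidable₁ P → ∀ k → P k →
        ∃[ m ] (P m × (∀ j → P j → m ≤ j))
least P? zero    p = 0 , p , λ _ _ → z≤n
least P? (suc k) p with P? 0
... | yes p₀ = 0 , p₀ , λ _ _ → z≤n
... | no ¬p₀ with least (P? ∘ suc) k p
...   | m , pm , min = suc m , pm , λ where
          zero    p₀ → ⊥-elim (¬p₀ p₀)
          (suc j) pj → s≤s (min j pj)

count : ∀ {n} {P : Pred (Fin n) 0ℓ} → Decidable₁ P → ℕ
count {n} P? = length (filter P? (allFin n))

-- Finite graphs of order n are taken on the vertex set Fin n.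
module _ {n : ℕ} (G : SimpleGraph (Fin n)) where
  open SimpleGraph G

  walk? : ∀ k u v → Dec (Walk G k u v)
  walk? zero    u v = map′ (λ { refl → stop }) (λ { stop → refl }) (u Fin.≟ v)
  walk? (suc k) u v = map′ (λ { (_ , e , p) → step e p }) (λ { (step e p) → _ , e , p })
                           (any? λ w → (u ~? w) ×-dec walk? k w v)

  degree : Fin n → ℕ
  degree v = count (v ~?_)

  #degreeTwo : ℕ
  #degreeTwo = count (λ v → degree v ≟ 2)

  -- Each edge is listed once, with its smaller endpoint first.
  edges : List (Fin n × Fin n)
  edges = filter (λ (u , v) → (u Fin.<? v) ×-dec (u ~? v))
                 (cartesianProduct (allFin n) (allFin n))

  module _ (conn : Connected G) where

    -- The walk given by conn only bounds the search for a shortest one.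
    dist : Fin n → Fin n → ℕ
    dist u v = let k , p = conn u v in proj₁ (least (λ m → walk? m u v) k p)

    #closer : Fin n → Fin n → ℕ
    #closer u v = count (λ w → dist w u <? dist w v)

    Mo : ℕ
    Mo = sum (map (λ (u , v) → ∣ #closer u v - #closer v u ∣) edges)

record 𝓔 (n t : ℕ) : Set₁ where
  field
    graph     : SimpleGraph (Fin n)
    isTree    : IsTree graph
    degreeTwo : #degreeTwo graph ≡ t
  open IsTree isTree public

  mostar : ℕ
  mostar = Mo graph connected

-- The vertex  on i j  is at distance  suc (toℕ j)  from the centre, on
-- leg i; so leg i has  ℓ i  edges.
data SpiderVertex {r : ℕ} (ℓ : Fin r → ℕ) : Set where
  centre : SpiderVertex ℓ
  on     : (i : Fin r) (j : Fin (ℓ i)) → SpiderVertex ℓ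

module _ {r : ℕ} (ℓ : Fin r → ℕ) where

  data _◁_ : Rel (SpiderVertex ℓ) 0ℓ where
    attach : ∀ {i j} → toℕ j ≡ 0 → centre ◁ on i j
    along  : ∀ {i j k} → toℕ k ≡ suc (toℕ j) → on i j ◁ on i k

  _◁?_ : Decidable _◁_
  centre ◁? centre = no λ ()
  centre ◁? on i j = map′ attach (λ { (attach e) → e }) (toℕ j ≟ 0)
  on i j ◁? centre = no λ ()
  on i j ◁? on h k with i Fin.≟ h
  ... | yes refl = map′ along (λ { (along e) → e }) (toℕ k ≟ suc (toℕ j))
  ... | no i≢h   = no λ { (along _) → i≢h refl }

  ◁-irrefl : ∀ {v} → ¬ (v ◁ v)
  ◁-irrefl (along e) = ℕ.1+n≢n (sym e)

  spider : SimpleGraph (SpiderVertex ℓ)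
  spider = record
    { _~_      = λ u v → u ◁ v ⊎ v ◁ u
    ; _~?_     = λ u v → (u ◁? v) ⊎-dec (v ◁? u)
    ; ~-sym    = swap
    ; ~-irrefl = λ { (inj₁ e) → ◁-irrefl e ; (inj₂ e) → ◁-irrefl e }
    }

-- The s longer legs come first.
legLength : (n r : ℕ) .{{_ : NonZero r}} → Fin r → ℕ
legLength n r i = if does (toℕ i <? s) then q + 1 else q
  where
  q = (n ∸ 1) / r
  s = (n ∸ 1) ∸ r * q

-- For r = n ∸ 1 every leg has length 1, so this is the star on n vertices.
S : (n r : ℕ) .{{_ : NonZero r}} → SimpleGraph (SpiderVertex (legLength n r))
S n r = spider (legLength n r)

n∸t∸1-nonZero : ∀ {n t} → t + 4 ≤ n → NonZero (n ∸ t ∸ 1)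
n∸t∸1-nonZero {n} {t} t+4≤n =
  >-nonZero (subst (0 <_) (sym (∸-+-assoc n t 1)) (m<n⇒0<n∸m t+1<n))
  where
  t+1<n : t + 1 < n
  t+1<n = ≤-trans (subst (_≤ t + 4) (ℕ.+-suc t 1) (+-monoʳ-≤ t (s≤s (s≤s z≤n)))) t+4≤n

{-# OPTIONS --safe #-}

-- Rooting a tree at c and counting, for every vertex w, the edges that w sees
-- in the opposite direction from c gives Mo + 2 D(c) ≥ (n − 1) n, where D(c)
-- is the sum of the distances to c, with equality when c minimises D.  So a
-- tree of maximum Mostar index has D(c) at most that of the spider's centre.
-- Conversely, at most r = n − t − 1 vertices lie at each distance from c,
-- since they have distinct leaves below them and a tree other than a path has
-- at most r leaves; this bounds D(c) from below by the value for the spider.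
-- Equality forces c to have r neighbours, which by the degree sum leaves all
-- other vertices with degree at most two, and fixes the lengths of the legs.

module Submission where

open import Defs
open import Data.Nat.Base
import Algebra.Properties.Semiring.Sum
open import Data.Bool.Base using (true; false; if_then_else_)
open import Data.Empty using (⊥; ⊥-elim)
open import Data.Fin.Base as Fin using (Fin; zero; suc; toℕ)
open import Data.Fin.Properties as Fin using (any?)
open import Data.List.Base as List
  using (List; []; _∷_; _++_; _∷ʳ_; allFin; cartesianProduct; filter; length; map)
open import Data.List.Membership.Propositional using (_∈_; _∉_)
open import Data.List.Properties using (map-++)
open import Data.List.Relation.Unary.All as All using (All; []; _∷_)
open import Data.List.Relation.Unary.All.Properties as All using ()
open import Data.List.Relation.Unary.AllPairs using ([]; _∷_)
open import Data.List.Relation.Unary.Any using (here; there)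
open import Data.List.Relation.Unary.Unique.Propositional using (Unique)
open import Data.List.Relation.Unary.Unique.Propositional.Properties as Unique using ()
open import Data.Nat.DivMod
import Data.Nat.ListAction as ListAction
import Data.Nat.ListAction.Properties as ListAction
open import Data.Nat.Properties
open import Data.Nat.Tactic.RingSolver using (solve-∀)
open import Data.Product.Base using (∃-syntax; _×_; _,_; proj₁; proj₂)
open import Data.Sum.Base using (_⊎_; inj₁; inj₂)
open import Function.Base using (_∘_; id)
open import Function.Bundles using (mk↔ₛ′; mk⇔)
open import Function.Definitions using (Injective)
open import Level using (0ℓ)
open import Relation.Binary.Definitions using (tri<; tri≈; tri>)
open import Relation.Binary.PropositionalEquality
open import Relation.Nullary
open import Relation.Nullary.Decidable using (_×-dec_; _⊎-dec_; decidable-stable)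
open import Relation.Unary using (Pred) renaming (Decidable to Decidable₁)

open Algebra.Properties.Semiring.Sum +-*-semiring
  using (sum; sum-syntax; sum-cong-≗; ∑-distrib-+; ∑-comm; *-distribˡ-sum)

-- The Mostar index of the spider is never computed: the inequality at the spider's centre and the
-- equality at a central vertex of the maximal tree already order the two distance sums. Acyclicity
-- is used only through `noOuterPath`, which yields both facts needed about distances: adjacent
-- vertices are never equidistant from a third vertex, and every vertex has just one neighbour
-- nearer to a given root. The distance sum is split into layers: `D(c)` is the sum over `k` of `n`
-- minus the number of vertices within distance `k`, and that number is at most `1 + k r`. With `q`
-- the integer part of `(n - 1) / r`, this bound exceeds `n` from `k = q + 1` on, so the sum is cut
-- after `k = q`. Comparing the cut sums makes the first `q + 1` balls as large as possible and also
-- keeps every vertex within distance `q + 1`. What remains is bookkeeping: `S n r` lists its long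
-- legs first, so the legs of the tree have to be sorted before they can be matched with those of
-- the spider.

private variable
  A B C : Set
  m n : ℕ

-- Indicators, finite sums and counting.

𝟙 : Dec A → ℕ
𝟙 a? = if does a? then 1 else 0

𝟙-yes : (a? : Dec A) → A → 𝟙 a? ≡ 1
𝟙-yes (yes _) _ = refl
𝟙-yes (no ¬a) a = contradiction a ¬a

𝟙-no : (a? : Dec A) → ¬ A → 𝟙 a? ≡ 0
𝟙-no (yes a) ¬a = contradiction a ¬a
𝟙-no (no _)  _  = refl

𝟙-mono : (a? : Dec A) (b? : Dec B) → (A → B) → 𝟙 a? ≤ 𝟙 b?
𝟙-mono (no _)  _  _ = z≤n
𝟙-mono (yes a) b? f = ≤-reflexive (sym (𝟙-yes b? (f a)))

𝟙-cong : (a? : Dec A) (b? : Dec B) → (A → B) → (B → A) → 𝟙 a? ≡ 𝟙 b?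
𝟙-cong a? b? f g = ≤-antisym (𝟙-mono a? b? f) (𝟙-mono b? a? g)

𝟙-× : (a? : Dec A) (b? : Dec B) → 𝟙 (a? ×-dec b?) ≡ 𝟙 a? * 𝟙 b?
𝟙-× (yes _) (yes _) = refl
𝟙-× (yes _) (no _)  = refl
𝟙-× (no _)  _       = refl

𝟙-⊎ : (a? : Dec A) (b? : Dec B) (c? : Dec C) →
      (A → ¬ B) → (A → C) → (B → C) → (C → ¬ A → B) → 𝟙 a? + 𝟙 b? ≡ 𝟙 c?
𝟙-⊎ (yes a) b? c? a#b f g h =
  trans (cong suc (𝟙-no b? (a#b a))) (sym (𝟙-yes c? (f a)))
𝟙-⊎ (no ¬a) b? c? a#b f g h = 𝟙-cong b? c? g (λ c → h c ¬a)

𝟙-*-mono : (a? : Dec A) → (A → m ≤ n) → 𝟙 a? * m ≤ 𝟙 a? * n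
𝟙-*-mono (yes a) m≤n = +-monoˡ-≤ 0 (m≤n a)
𝟙-*-mono (no _)  _   = z≤n

𝟙-*-cong : (a? : Dec A) → (A → m ≡ n) → 𝟙 a? * m ≡ 𝟙 a? * n
𝟙-*-cong (yes a) m≡n = cong (_+ 0) (m≡n a)
𝟙-*-cong (no _)  _   = refl

sum-mono : {f g : Fin n → ℕ} → (∀ i → f i ≤ g i) → sum f ≤ sum g
sum-mono {zero}  f≤g = z≤n
sum-mono {suc n} f≤g = +-mono-≤ (f≤g zero) (sum-mono (f≤g ∘ suc))

-- The source of every equality case below: for the depths, the number of leaves, the balls and the
-- degrees.
sum-tight : {f g : Fin n → ℕ} → (∀ i → f i ≤ g i) → sum g ≤ sum f → ∀ i → f i ≡ g i
sum-tight {suc n} {f} {g} f≤g Σg≤Σf zero    = ≤-antisym (f≤g zero)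
  (+-cancelʳ-≤ _ _ _ (≤-trans (+-monoʳ-≤ (g zero) (sum-mono (f≤g ∘ suc))) Σg≤Σf))
sum-tight {suc n} {f} {g} f≤g Σg≤Σf (suc i) = sum-tight (f≤g ∘ suc)
  (+-cancelˡ-≤ (f zero) _ _ (≤-trans (+-monoˡ-≤ _ (f≤g zero)) Σg≤Σf)) i

term≤sum : (f : Fin n → ℕ) → ∀ i → f i ≤ sum f
term≤sum f zero    = m≤m+n _ _
term≤sum f (suc i) = m≤n⇒m≤o+n (f zero) (term≤sum (f ∘ suc) i)

sum-const : ∀ n k → ∑[ i < n ] k ≡ n * k
sum-const zero    k = refl
sum-const (suc n) k = cong (k +_) (sum-const n k)

sum₂-cong : {f g : Fin m → Fin n → ℕ} → (∀ i j → f i j ≡ g i j) →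
            ∑[ i < m ] ∑[ j < n ] f i j ≡ ∑[ i < m ] ∑[ j < n ] g i j
sum₂-cong f≗g = sum-cong-≗ (λ i → sum-cong-≗ (f≗g i))

sum₂-mono : {f g : Fin m → Fin n → ℕ} → (∀ i j → f i j ≤ g i j) →
            ∑[ i < m ] ∑[ j < n ] f i j ≤ ∑[ i < m ] ∑[ j < n ] g i j
sum₂-mono f≤g = sum-mono (λ i → sum-mono (f≤g i))

sum₂-+ : (f g : Fin m → Fin n → ℕ) →
         ∑[ i < m ] ∑[ j < n ] (f i j + g i j) ≡
         ∑[ i < m ] ∑[ j < n ] f i j + ∑[ i < m ] ∑[ j < n ] g i j
sum₂-+ f g = trans (sum-cong-≗ (λ i → ∑-distrib-+ (f i) (g i)))
                   (∑-distrib-+ (λ i → sum (f i)) (λ i → sum (g i)))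

sum₂-* : ∀ k (f : Fin m → Fin n → ℕ) →
         k * ∑[ i < m ] ∑[ j < n ] f i j ≡ ∑[ i < m ] ∑[ j < n ] (k * f i j)
sum₂-* k f = trans (*-distribˡ-sum k (λ i → sum (f i)))
                   (sum-cong-≗ (λ i → *-distribˡ-sum k (f i)))

# : {P : Pred (Fin n) 0ℓ} → Decidable₁ P → ℕ
# P? = sum (𝟙 ∘ P?)

private variable
  P Q : Pred (Fin n) 0ℓ

#-cong : (P? : Decidable₁ P) (Q? : Decidable₁ Q) →
         (∀ i → P i → Q i) → (∀ i → Q i → P i) → # P? ≡ # Q?
#-cong P? Q? f g = sum-cong-≗ (λ i → 𝟙-cong (P? i) (Q? i) (f i) (g i))

#-none : (P? : Decidable₁ P) → (∀ i → ¬ P i) → # P? ≡ 0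
#-none {n} P? none = trans (sum-cong-≗ (λ i → 𝟙-no (P? i) (none i)))
                           (trans (sum-const n 0) (*-zeroʳ n))

#-singleton : (k : Fin n) → # (Fin._≟ k) ≡ 1
#-singleton {suc n} zero    = cong suc (#-none {n} (λ i → suc i Fin.≟ zero) (λ _ ()))
#-singleton {suc n} (suc k) =
  trans (#-cong (λ i → suc i Fin.≟ suc k) (Fin._≟ k) (λ _ → Fin.suc-injective) (λ _ → cong suc))
        (#-singleton k)

#-unique : (P? : Decidable₁ P) → ∀ k → P k → (∀ i → P i → i ≡ k) → # P? ≡ 1
#-unique P? k Pk unique =
  trans (#-cong P? (Fin._≟ k) unique (λ { i refl → Pk })) (#-singleton k)

#-positive : (P? : Decidable₁ P) → ∀ k → P k → 1 ≤ # P?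
#-positive P? k Pk = subst (_≤ # P?) (𝟙-yes (P? k) Pk) (term≤sum (𝟙 ∘ P?) k)

#-other : (P? : Decidable₁ P) → 2 ≤ # P? → ∀ k → ∃[ i ] (P i × i ≢ k)
#-other P? 2≤# k with any? (λ i → P? i ×-dec ¬? (i Fin.≟ k))
... | yes found = found
... | no  none  = contradiction (≤-trans 2≤# (≤-trans (sum-mono only) (≤-reflexive (#-singleton k))))
                                λ { (s≤s ()) }
  where
  only : ∀ i → 𝟙 (P? i) ≤ 𝟙 (i Fin.≟ k)
  only i = 𝟙-mono (P? i) (i Fin.≟ k) λ Pi → decidable-stable (i Fin.≟ k) λ i≢k → none (i , Pi , i≢k)

#-strict : (P? : Decidable₁ P) (Q? : Decidable₁ Q) → (∀ i → P i → Q i) →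
           ∀ k → Q k → ¬ P k → # P? < # Q?
#-strict {n} P? Q? P⊆Q k Qk ¬Pk = begin
  suc (# P?)                                ≡⟨ +-comm 1 (# P?) ⟩
  # P? + 1                                  ≡⟨ cong (# P? +_) (#-singleton k) ⟨
  # P? + # (Fin._≟ k)                       ≡⟨ ∑-distrib-+ (𝟙 ∘ P?) (λ i → 𝟙 (i Fin.≟ k)) ⟨
  ∑[ i < n ] (𝟙 (P? i) + 𝟙 (i Fin.≟ k))     ≤⟨ sum-mono one ⟩
  # Q?                                      ∎
  where
  open ≤-Reasoning
  one : ∀ i → 𝟙 (P? i) + 𝟙 (i Fin.≟ k) ≤ 𝟙 (Q? i)
  one i with i Fin.≟ k
  ... | yes refl rewrite 𝟙-no (P? i) ¬Pk = ≤-reflexive (sym (𝟙-yes (Q? i) Qk))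
  ... | no _ = ≤-trans (≤-reflexive (+-identityʳ _)) (𝟙-mono (P? i) (Q? i) (P⊆Q i))

#-three : (P? : Decidable₁ P) → ∀ {a b c} → P a → P b → P c → a ≢ b → a ≢ c → b ≢ c → 3 ≤ # P?
#-three {n} P? {a} {b} {c} Pa Pb Pc a≢b a≢c b≢c = begin
  3
    ≡⟨ cong₂ _+_ (#-singleton a) (cong₂ _+_ (#-singleton b) (#-singleton c)) ⟨
  # (Fin._≟ a) + (# (Fin._≟ b) + # (Fin._≟ c))
    ≡⟨ cong (# (Fin._≟ a) +_) (∑-distrib-+ (λ i → 𝟙 (i Fin.≟ b)) (λ i → 𝟙 (i Fin.≟ c))) ⟨
  # (Fin._≟ a) + ∑[ i < n ] (𝟙 (i Fin.≟ b) + 𝟙 (i Fin.≟ c))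
    ≡⟨ ∑-distrib-+ (λ i → 𝟙 (i Fin.≟ a)) (λ i → 𝟙 (i Fin.≟ b) + 𝟙 (i Fin.≟ c)) ⟨
  ∑[ i < n ] (𝟙 (i Fin.≟ a) + (𝟙 (i Fin.≟ b) + 𝟙 (i Fin.≟ c)))  ≤⟨ sum-mono one ⟩
  # P?                                                          ∎
  where
  open ≤-Reasoning
  one : ∀ i → 𝟙 (i Fin.≟ a) + (𝟙 (i Fin.≟ b) + 𝟙 (i Fin.≟ c)) ≤ 𝟙 (P? i)
  one i with i Fin.≟ a
  ... | yes refl rewrite 𝟙-no (a Fin.≟ b) a≢b | 𝟙-no (a Fin.≟ c) a≢c =
    ≤-reflexive (sym (𝟙-yes (P? a) Pa))
  ... | no _ with i Fin.≟ b
  ...   | yes refl rewrite 𝟙-no (b Fin.≟ c) b≢c = ≤-reflexive (sym (𝟙-yes (P? b) Pb))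
  ...   | no _ = 𝟙-mono (i Fin.≟ c) (P? i) λ { refl → Pc }

-- Double counting of the pairs with `x ≡ g y` and `Q y`: each `x` in `P` occurs at least once, each
-- `y` in `Q` exactly once.
#-surjection : {P : Pred (Fin n) 0ℓ} {Q : Pred (Fin m) 0ℓ}
               (P? : Decidable₁ P) (Q? : Decidable₁ Q) (g : Fin m → Fin n) →
               (∀ x → P x → ∃[ y ] (Q y × g y ≡ x)) → # P? ≤ # Q?
#-surjection {n} {m} P? Q? g lift = begin
  # P?                                                ≤⟨ sum-mono fibre ⟩
  ∑[ x < n ] ∑[ y < m ] (𝟙 (Q? y) * 𝟙 (x Fin.≟ g y))  ≡⟨ ∑-comm (λ x y → 𝟙 (Q? y) * 𝟙 (x Fin.≟ g y)) ⟩
  ∑[ y < m ] ∑[ x < n ] (𝟙 (Q? y) * 𝟙 (x Fin.≟ g y))  ≡⟨ sum-cong-≗ total ⟩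
  # Q?                                                ∎
  where
  open ≤-Reasoning
  fibre : ∀ x → 𝟙 (P? x) ≤ ∑[ y < m ] (𝟙 (Q? y) * 𝟙 (x Fin.≟ g y))
  fibre x with P? x
  ... | no  _  = z≤n
  ... | yes Px with y , Qy , refl ← lift x Px =
    ≤-trans (≤-reflexive (sym (cong₂ _*_ (𝟙-yes (Q? y) Qy) (𝟙-yes (g y Fin.≟ g y) refl))))
            (term≤sum (λ y → 𝟙 (Q? y) * 𝟙 (x Fin.≟ g y)) y)
  total : ∀ y → ∑[ x < n ] (𝟙 (Q? y) * 𝟙 (x Fin.≟ g y)) ≡ 𝟙 (Q? y)
  total y = trans (sym (*-distribˡ-sum (𝟙 (Q? y)) (λ x → 𝟙 (x Fin.≟ g y))))
                  (trans (cong (𝟙 (Q? y) *_) (#-singleton (g y))) (*-identityʳ _))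

#-initial : ∀ n m → m ≤ n → # {n} (λ i → toℕ i <? m) ≡ m
#-initial n       zero    _         = #-none {n} (λ i → toℕ i <? 0) (λ _ ())
#-initial (suc n) (suc m) (s≤s m≤n) = cong suc
  (trans (#-cong {n} (λ i → toℕ (suc i) <? suc m) (λ i → toℕ i <? m) (λ _ → s≤s⁻¹) (λ _ → s≤s))
         (#-initial n m m≤n))

sum-below : ∀ m d → ∑[ k < m ] 𝟙 (d ≤? toℕ k) ≡ m ∸ d
sum-below zero    zero    = refl
sum-below zero    (suc d) = refl
sum-below (suc m) zero    = cong suc
  (trans (sum-cong-≗ {m} (λ k → 𝟙-cong (0 ≤? suc (toℕ k)) (0 ≤? toℕ k) (λ _ → z≤n) (λ _ → z≤n)))
         (sum-below m zero))
sum-below (suc m) (suc d) =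
  trans (sum-cong-≗ {m} (λ k → 𝟙-cong (suc d ≤? suc (toℕ k)) (d ≤? toℕ k) s≤s⁻¹ s≤s))
        (sum-below m d)

count≡# : (P? : Decidable₁ P) → count P? ≡ # P?
count≡# P? = go P? id
  where
  go : {P : Pred (Fin n) 0ℓ} (P? : Decidable₁ P) (f : Fin m → Fin n) →
       length (filter P? (List.tabulate f)) ≡ ∑[ i < m ] 𝟙 (P? (f i))
  go {m = zero}  P? f = refl
  go {m = suc m} P? f with does (P? (f zero))
  ... | true  = cong suc (go P? (f ∘ suc))
  ... | false = go P? (f ∘ suc)

-- Brings the list sum in `Mo` into a form where the order of summation can be exchanged.
sum-cartesianProduct : {P : Pred (Fin m × Fin n) 0ℓ} (P? : Decidable₁ P) (f : Fin m × Fin n → ℕ) →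
  ListAction.sum (map f (filter P? (cartesianProduct (allFin m) (allFin n)))) ≡
  ∑[ i < m ] ∑[ j < n ] (𝟙 (P? (i , j)) * f (i , j))
sum-cartesianProduct {m} {n} {P} P? f =
  trans (filtered (cartesianProduct (allFin m) (allFin n))) (product id)
  where
  open ≡-Reasoning
  h : Fin m × Fin n → ℕ
  h x = 𝟙 (P? x) * f x

  filtered : ∀ xs → ListAction.sum (map f (filter P? xs)) ≡ ListAction.sum (map h xs)
  filtered []       = refl
  filtered (x ∷ xs) with does (P? x)
  ... | true  = cong₂ _+_ (sym (+-identityʳ (f x))) (filtered xs)
  ... | false = filtered xs

  row : ∀ {k} i (e : Fin k → Fin n) →
        ListAction.sum (map h (map (i ,_) (List.tabulate e))) ≡ ∑[ j < k ] h (i , e j)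
  row {zero}  i e = refl
  row {suc k} i e = cong (h (i , e zero) +_) (row i (e ∘ suc))

  product : ∀ {k} (e : Fin k → Fin m) →
            ListAction.sum (map h (cartesianProduct (List.tabulate e) (allFin n))) ≡
            ∑[ i < k ] ∑[ j < n ] h (e i , j)
  product {zero}  e = refl
  product {suc k} e = begin
    ListAction.sum (map h (first ++ rest))                ≡⟨ cong ListAction.sum (map-++ h first rest) ⟩
    ListAction.sum (map h first ++ map h rest)            ≡⟨ ListAction.sum-++ (map h first) _ ⟩
    ListAction.sum (map h first) + ListAction.sum (map h rest)
      ≡⟨ cong₂ _+_ (row (e zero) id) (product (e ∘ suc)) ⟩
    ∑[ i < suc k ] ∑[ j < n ] h (e i , j)           ∎
    where
    first = map (e zero ,_) (allFin n)
    rest  = cartesianProduct (List.tabulate (e ∘ suc)) (allFin n)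

if-yes : ∀ {A B : Set} {x y : B} (a? : Dec A) → A → (if does a? then x else y) ≡ x
if-yes (yes _) _ = refl
if-yes (no ¬a) a = contradiction a ¬a

if-no : ∀ {A B : Set} {x y : B} (a? : Dec A) → ¬ A → (if does a? then x else y) ≡ y
if-no (yes a) ¬a = contradiction a ¬a
if-no (no _)  _  = refl

-- Punching out a missed value would inject `Fin (suc n)` into `Fin n`.
injective⇒surjective : ∀ {n} {f : Fin n → Fin n} → Injective _≡_ _≡_ f → ∀ y → ∃[ x ] f x ≡ y
injective⇒surjective {suc n} {f} f-injective y with any? (λ x → f x Fin.≟ y)
... | yes found = found
... | no  none  = contradiction (Fin.injective⇒≤ {f = λ x → Fin.punchOut (missed x)}
    (λ eq → f-injective (Fin.punchOut-injective (missed _) (missed _) eq))) 1+n≰n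
  where
  missed : ∀ x → y ≢ f x
  missed x eq = none (x , sym eq)

-- Walks, and distances in connected graphs and in trees.

module _ {V : Set} (G : SimpleGraph V) where
  open SimpleGraph G

  private variable
    k l : ℕ
    u v w : V

  snoc : Walk G k u v → v ~ w → Walk G (suc k) u w
  snoc stop       e = step e stop
  snoc (step f p) e = step f (snoc p e)

  reverse : Walk G k u v → Walk G k v u
  reverse stop       = stop
  reverse (step e p) = snoc (reverse p) (~-sym e)

  append : Walk G k u v → Walk G l v w → Walk G (k + l) u w
  append stop       q = q
  append (step e p) q = step e (append p q)

  vertices-snoc : (p : Walk G k u v) (e : v ~ w) →
                  walkVertices G (snoc p e) ≡ walkVertices G p ∷ʳ w
  vertices-snoc stop       e = refl
  vertices-snoc (step f p) e = cong (_ ∷_) (vertices-snoc p e)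

  start∈ : (p : Walk G k u v) → u ∈ walkVertices G p
  start∈ stop       = here refl
  start∈ (step _ _) = here refl

  end∈ : (p : Walk G k u v) → v ∈ walkVertices G p
  end∈ stop       = here refl
  end∈ (step _ p) = there (end∈ p)

module Distance {n : ℕ} (G : SimpleGraph (Fin n)) (conn : Connected G) where
  open SimpleGraph G

  d : Fin n → Fin n → ℕ
  d = dist G conn

  geodesic : ∀ u v → Walk G (d u v) u v
  geodesic u v = proj₁ (proj₂ (least (λ m → walk? G m u v) _ (proj₂ (conn u v))))

  d-min : ∀ {k u v} → Walk G k u v → d u v ≤ k
  d-min {k} {u} {v} p = proj₂ (proj₂ (least (λ m → walk? G m u v) _ (proj₂ (conn u v)))) k p

  d-sym : ∀ u v → d u v ≡ d v u
  d-sym u v = ≤-antisym (d-min (reverse G (geodesic v u))) (d-min (reverse G (geodesic u v)))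

  d-refl : ∀ u → d u u ≡ 0
  d-refl u = n≤0⇒n≡0 (d-min stop)

  d≡0⇒≡ : ∀ {u v} → d u v ≡ 0 → u ≡ v
  d≡0⇒≡ {u} {v} eq with subst (λ k → Walk G k u v) eq (geodesic u v)
  ... | stop = refl

  d-step : ∀ w {u v} → u ~ v → d w v ≤ suc (d w u)
  d-step w {u} u~v = d-min (snoc G (geodesic w u) u~v)

  closerNeighbour : ∀ {w u} → u ≢ w → ∃[ v ] (v ~ u × suc (d w v) ≡ d w u)
  closerNeighbour {w} {u} u≢w = first (geodesic u w) refl
    where
    first : ∀ {k} → Walk G k u w → k ≡ d u w → ∃[ v ] (v ~ u × suc (d w v) ≡ d w u)
    first stop       _  = contradiction refl u≢w
    first (step {w = v} u~v p) eq = v , ~-sym u~v , ≤-antisym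
      (subst₂ (λ a b → suc a ≤ b) (d-sym v w) (trans eq (d-sym u w)) (s≤s (d-min p)))
      (d-step w (~-sym u~v))

module Tree {n : ℕ} (G : SimpleGraph (Fin n)) (isTree : IsTree G) where
  open SimpleGraph G
  open IsTree isTree
  open Distance G connected public

  -- Joining the ends of such a path to their neighbours closer to w
  -- gives a longer path of the same kind, or closes a cycle.
  noOuterPath : ∀ w r {k u v} (p : Walk G (suc k) u v) → Unique (walkVertices G p) →
                d w u ≡ r → d w v ≡ r → All (λ x → r ≤ d w x) (walkVertices G p) → ⊥
  noOuterPath w zero p@(step _ p′) (u∉ ∷ _) du dv _ =
    All.lookup u∉ (end∈ G p′) (trans (sym (d≡0⇒≡ du)) (d≡0⇒≡ dv))
  noOuterPath w (suc r) {u = u} {v} p distinct du dv far =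
    extend (closerNeighbour (away du)) (closerNeighbour (away dv))
    where
    away : ∀ {x} → d w x ≡ suc r → x ≢ w
    away dx refl = 0≢1+n (trans (sym (d-refl w)) dx)

    fresh : ∀ {x} → d w x ≡ r → x ∉ walkVertices G p
    fresh dx x∈ = 1+n≰n (≤-trans (All.lookup far x∈) (≤-reflexive dx))

    extend : ∃[ a ] (a ~ u × suc (d w a) ≡ d w u) → ∃[ b ] (b ~ v × suc (d w b) ≡ d w v) → ⊥
    extend (a , a~u , da) (b , b~v , db) with a Fin.≟ b
    ... | yes refl = acyclic record
      { path     = step a~u p
      ; distinct = All.¬Any⇒All¬ _ (fresh da′) ∷ distinct
      ; closing  = ~-sym b~v
      }
      where
      da′ = suc-injective (trans da du)
    ... | no a≢b = noOuterPath w r q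
      (subst Unique (sym verts) (Unique.++⁺ (All.¬Any⇒All¬ _ (fresh da′) ∷ distinct) ([] ∷ []) b∉))
      da′ db′
      (subst (All _) (sym verts)
        (All.++⁺ (≤-reflexive (sym da′) ∷ All.map (≤-trans (n≤1+n r)) far) (≤-reflexive (sym db′) ∷ [])))
      where
      q = snoc G (step a~u p) (~-sym b~v)
      verts = vertices-snoc G (step a~u p) (~-sym b~v)
      da′ = suc-injective (trans da du)
      db′ = suc-injective (trans db dv)
      b∉ : ∀ {x} → ¬ (x ∈ a ∷ walkVertices G p × x ∈ b ∷ [])
      b∉ (here refl , here refl) = a≢b refl
      b∉ (there x∈  , here refl) = fresh db′ x∈

  -- Trees are bipartite: an edge between equidistant vertices would be a path of one edge of the
  -- kind excluded by `noOuterPath`.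
  d-≢ : ∀ w {u v} → u ~ v → d w u ≢ d w v
  d-≢ w {u} {v} u~v eq = noOuterPath w (d w v) (step u~v stop)
    (((λ { refl → ~-irrefl u~v }) ∷ []) ∷ [] ∷ []) eq refl
    (≤-reflexive (sym eq) ∷ ≤-refl ∷ [])

  d-closer : ∀ w {u v} → u ~ v → d w u < d w v → suc (d w u) ≡ d w v
  d-closer w u~v u<v = ≤-antisym u<v (d-step w u~v)

  -- Both neighbours lie one step nearer than `x`, so if they differed, the path `u`, `x`, `v` would
  -- be excluded by `noOuterPath`.
  closer-unique : ∀ w {u v x} → u ~ x → v ~ x → d w u < d w x → d w v < d w x → u ≡ v
  closer-unique w {u} {v} {x} u~x v~x u<x v<x with u Fin.≟ v
  ... | yes u≡v = u≡v
  ... | no  u≢v = ⊥-elim (noOuterPath w (d w v) (step u~x (step (~-sym v~x) stop))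
    (((λ { refl → ~-irrefl u~x }) ∷ u≢v ∷ []) ∷ ((λ { refl → ~-irrefl v~x }) ∷ []) ∷ [] ∷ [])
    du refl (≤-reflexive (sym du) ∷ <⇒≤ v<x ∷ ≤-refl ∷ []))
    where
    du : d w u ≡ d w v
    du = suc-injective (trans (d-closer w u~x u<x) (sym (d-closer w v~x v<x)))

  closer-or-farther : ∀ w {u v} → u ~ v → d w u < d w v ⊎ d w v < d w u
  closer-or-farther w {u} {v} u~v with <-cmp (d w u) (d w v)
  ... | tri< lt _ _ = inj₁ lt
  ... | tri≈ _ eq _ = contradiction eq (d-≢ w u~v)
  ... | tri> _ _ gt = inj₂ gt

  -- Moving the root along an edge turns over only that edge.
  flip-unique : ∀ {w w′ u v} → w ~ w′ → u ~ v → d w v < d w u → d w′ u < d w′ v →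
                v ≡ w × u ≡ w′
  flip-unique {w} {w′} {u} {v} w~w′ u~v v<u u<v = v≡w , u≡w′
    where
    near : ∀ x → d w′ x ≤ suc (d w x)
    near x = subst₂ _≤_ (d-sym x w′) (cong suc (d-sym x w)) (d-step x w~w′)
    near′ : ∀ x → d w x ≤ suc (d w′ x)
    near′ x = subst₂ _≤_ (d-sym x w) (cong suc (d-sym x w′)) (d-step x (~-sym w~w′))
    d-wu : suc (d w v) ≡ d w u
    d-wu = d-closer w (~-sym u~v) v<u
    d-w′v : suc (d w′ u) ≡ d w′ v
    d-w′v = d-closer w′ u~v u<v
    same : d w′ u ≡ d w v
    same = ≤-antisym (s≤s⁻¹ (≤-trans (≤-reflexive d-w′v) (near v)))
                     (s≤s⁻¹ (≤-trans (≤-reflexive d-wu) (near′ u)))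
    v≡w : v ≡ w
    v≡w with v Fin.≟ w
    ... | yes v≡w = v≡w
    -- Let `x` be the neighbour of `v` towards `w`. If it precedes `v` seen from `w′`, it is `u`,
    -- but `u` follows `v` seen from `w`. If it follows `v`, then `v` is no farther from `w′` than
    -- `u` is.
    ... | no  v≢w with x , x~v , dx ← closerNeighbour v≢w with closer-or-farther w′ x~v
    ...   | inj₁ x<v with refl ← closer-unique w′ x~v u~v x<v u<v =
      ⊥-elim (<-asym v<u (subst (suc (d w x) ≤_) dx ≤-refl))
    ...   | inj₂ v<x = contradiction u<v (≤⇒≯ (begin
      d w′ v       ≤⟨ <⇒≤ v<x ⟩
      d w′ x       ≤⟨ near x ⟩
      suc (d w x)  ≡⟨ dx ⟩
      d w v        ≡⟨ same ⟨
      d w′ u       ∎))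
      where open ≤-Reasoning
    u≡w′ : u ≡ w′
    u≡w′ = sym (d≡0⇒≡ (trans same (trans (cong (d w) v≡w) (d-refl w))))

-- The Mostar index and the distance sum.

module Mostar {n : ℕ} (G : SimpleGraph (Fin n)) (isTree : IsTree G) where
  open SimpleGraph G
  open Tree G isTree public

  degree≡# : ∀ v → degree G v ≡ # (v ~?_)
  degree≡# v = count≡# (v ~?_)

  -- Both sums run over the edges, the first over one orientation of each
  -- edge, the second over both.
  orientation : ∀ {R : Fin n → Fin n → Set} (R? : ∀ u v → Dec (R u v)) →
                (∀ u v → 𝟙 (R? u v) + 𝟙 (R? v u) ≡ 𝟙 (u ~? v)) →
                ∀ (h : Fin n → Fin n → ℕ) → (∀ u v → h u v ≡ h v u) →
                2 * ∑[ u < n ] ∑[ v < n ] (𝟙 (R? u v) * h u v) ≡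
                ∑[ u < n ] ∑[ v < n ] (𝟙 (u ~? v) * h u v)
  orientation R? split h h-sym = begin
    2 * half     ≡⟨ cong (half +_) (+-identityʳ half) ⟩
    half + half
      ≡⟨ cong (half +_) (∑-comm (λ u v → 𝟙 (R? u v) * h u v)) ⟩
    half + ∑[ v < n ] ∑[ u < n ] (𝟙 (R? u v) * h u v)
      ≡⟨ sum₂-+ (λ u v → 𝟙 (R? u v) * h u v) (λ v u → 𝟙 (R? u v) * h u v) ⟨
    ∑[ u < n ] ∑[ v < n ] (𝟙 (R? u v) * h u v + 𝟙 (R? v u) * h v u)
      ≡⟨ sum₂-cong combine ⟩
    ∑[ u < n ] ∑[ v < n ] (𝟙 (u ~? v) * h u v)           ∎
    where
    open ≡-Reasoning
    half = ∑[ u < n ] ∑[ v < n ] (𝟙 (R? u v) * h u v)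
    combine : ∀ u v → 𝟙 (R? u v) * h u v + 𝟙 (R? v u) * h v u ≡ 𝟙 (u ~? v) * h u v
    combine u v = begin
      𝟙 (R? u v) * h u v + 𝟙 (R? v u) * h v u
        ≡⟨ cong (λ x → 𝟙 (R? u v) * h u v + 𝟙 (R? v u) * x) (h-sym v u) ⟩
      𝟙 (R? u v) * h u v + 𝟙 (R? v u) * h u v  ≡⟨ *-distribʳ-+ (h u v) (𝟙 (R? u v)) (𝟙 (R? v u)) ⟨
      (𝟙 (R? u v) + 𝟙 (R? v u)) * h u v        ≡⟨ cong (_* h u v) (split u v) ⟩
      𝟙 (u ~? v) * h u v                       ∎

  closer : Fin n → Fin n → ℕ
  closer u v = # (λ w → d w u <? d w v)

  -- By `d-≢` no vertex is equidistant from the ends of an edge.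
  closer-+ : ∀ {u v} → u ~ v → closer u v + closer v u ≡ n
  closer-+ {u} {v} u~v = begin
    closer u v + closer v u
      ≡⟨ ∑-distrib-+ (λ w → 𝟙 (d w u <? d w v)) (λ w → 𝟙 (d w v <? d w u)) ⟨
    ∑[ w < n ] (𝟙 (d w u <? d w v) + 𝟙 (d w v <? d w u))   ≡⟨ sum-cong-≗ one ⟩
    ∑[ w < n ] 1                                           ≡⟨ sum-const n 1 ⟩
    n * 1                                                  ≡⟨ *-identityʳ n ⟩
    n                                                      ∎
    where
    open ≡-Reasoning
    one : ∀ w → 𝟙 (d w u <? d w v) + 𝟙 (d w v <? d w u) ≡ 1
    one w with closer-or-farther w u~v
    ... | inj₁ lt = cong₂ _+_ (𝟙-yes (d w u <? d w v) lt) (𝟙-no (d w v <? d w u) (<-asym lt))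
    ... | inj₂ gt = cong₂ _+_ (𝟙-no (d w u <? d w v) (<-asym gt)) (𝟙-yes (d w v <? d w u) gt)

  -- This is `D` of the overview, also called the transmission of a vertex.
  status : Fin n → ℕ
  status c = ∑[ w < n ] d c w

  module Rooted (c : Fin n) where

    Down : Fin n → Fin n → Set
    Down u v = u ~ v × d c u < d c v

    down? : ∀ u v → Dec (Down u v)
    down? u v = (u ~? v) ×-dec (d c u <? d c v)

    down-split : ∀ u v → 𝟙 (down? u v) + 𝟙 (down? v u) ≡ 𝟙 (u ~? v)
    down-split u v = 𝟙-⊎ (down? u v) (down? v u) (u ~? v)
      (λ (_ , lt) (_ , gt) → <-asym lt gt) proj₁ (~-sym ∘ proj₁) either
      where
      either : u ~ v → ¬ Down u v → Down v u
      either u~v not with closer-or-farther c u~v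
      ... | inj₁ lt = contradiction (u~v , lt) not
      ... | inj₂ gt = ~-sym u~v , gt

    -- The second indicator makes up for the root, which alone has no parent; the sum over `v` then
    -- counts the edges as `n - 1`.
    #parents : ∀ v → # (λ u → down? u v) + 𝟙 (v Fin.≟ c) ≡ 1
    #parents v with v Fin.≟ c
    ... | yes refl = cong (_+ 1) (#-none (λ u → down? u v)
                       (λ u (_ , lt) → n≮0 (subst (d v u <_) (d-refl v) lt)))
    ... | no  v≢c with p , p~v , dp ← closerNeighbour v≢c =
      cong (_+ 0) (#-unique (λ u → down? u v) p (p~v , ≤-reflexive dp)
        (λ u (u~v , lt) → closer-unique c u~v p~v lt (≤-reflexive dp)))

    #edges : suc (∑[ u < n ] ∑[ v < n ] 𝟙 (down? u v)) ≡ n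
    #edges = begin
      suc (∑[ u < n ] ∑[ v < n ] 𝟙 (down? u v))  ≡⟨ cong suc (∑-comm (λ u v → 𝟙 (down? u v))) ⟩
      suc arcs                                      ≡⟨ +-comm 1 arcs ⟩
      arcs + 1                                      ≡⟨ cong (arcs +_) (#-singleton c) ⟨
      arcs + # (Fin._≟ c)
        ≡⟨ ∑-distrib-+ (λ v → # (λ u → down? u v)) (λ v → 𝟙 (v Fin.≟ c)) ⟨
      ∑[ v < n ] (# (λ u → down? u v) + 𝟙 (v Fin.≟ c)) ≡⟨ sum-cong-≗ #parents ⟩
      ∑[ v < n ] 1                               ≡⟨ sum-const n 1 ⟩
      n * 1                                      ≡⟨ *-identityʳ n ⟩
      n                                          ∎
      where
      open ≡-Reasoning
      arcs = ∑[ v < n ] # (λ u → down? u v)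

    -- The handshake lemma for `n - 1` edges, written without subtraction.
    degree-sum : 2 + ∑[ v < n ] degree G v ≡ 2 * n
    degree-sum = begin
      2 + ∑[ v < n ] degree G v                       ≡⟨ cong (2 +_) (sum-cong-≗ degree≡#) ⟩
      2 + ∑[ u < n ] ∑[ v < n ] 𝟙 (u ~? v)
        ≡⟨ cong (2 +_) (sum₂-cong (λ u v → *-identityʳ (𝟙 (u ~? v)))) ⟨
      2 + ∑[ u < n ] ∑[ v < n ] (𝟙 (u ~? v) * 1)
        ≡⟨ cong (2 +_) (orientation down? down-split (λ _ _ → 1) (λ _ _ → refl)) ⟨
      2 + 2 * ∑[ u < n ] ∑[ v < n ] (𝟙 (down? u v) * 1)
        ≡⟨ cong (λ e → 2 + 2 * e) (sum₂-cong (λ u v → *-identityʳ (𝟙 (down? u v)))) ⟩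
      2 + 2 * E                                       ≡⟨ *-suc 2 E ⟨
      2 * suc E                                       ≡⟨ cong (2 *_) #edges ⟩
      2 * n                                           ∎
      where
      open ≡-Reasoning
      E = ∑[ u < n ] ∑[ v < n ] 𝟙 (down? u v)

    turned? : ∀ w u v → Dec (Down u v × d w v < d w u)
    turned? w u v = down? u v ×-dec (d w v <? d w u)

    -- The turned edges are those of the path from `c` to `w`. Induction along it: by `flip-unique`,
    -- passing from the parent `w′` to `w` turns the edge between them and leaves all others as they
    -- were.
    #turned : ∀ w → ∑[ u < n ] ∑[ v < n ] 𝟙 (turned? w u v) ≡ d c w
    #turned w = go (d c w) w refl
      where
      go : ∀ k w → d c w ≡ k → ∑[ u < n ] ∑[ v < n ] 𝟙 (turned? w u v) ≡ k
      go zero w dw with refl ← d≡0⇒≡ dw =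
        trans (sum-cong-≗ (λ u → #-none (turned? w u) (λ v ((_ , lt) , gt) → <-asym lt gt)))
              (trans (sum-const n 0) (*-zeroʳ n))
      go (suc k) w dw with w′ , w′~w , dw′ ← closerNeighbour {c} {w}
                             (λ { refl → 0≢1+n (trans (sym (d-refl c)) dw) }) = begin
        ∑[ u < n ] ∑[ v < n ] 𝟙 (turned? w u v)
          ≡⟨ sum₂-cong (λ u v → sym (𝟙-⊎ (turned? w′ u v) (new? u v) (turned? w u v)
               (disjoint u v) (old u v) (fresh u v) (cover u v))) ⟩
        ∑[ u < n ] ∑[ v < n ] (𝟙 (turned? w′ u v) + 𝟙 (new? u v))
          ≡⟨ sum₂-+ (λ u v → 𝟙 (turned? w′ u v)) (λ u v → 𝟙 (new? u v)) ⟩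
        ∑[ u < n ] ∑[ v < n ] 𝟙 (turned? w′ u v) + ∑[ u < n ] ∑[ v < n ] 𝟙 (new? u v)
          ≡⟨ cong₂ _+_ (go k w′ (suc-injective (trans dw′ dw))) one ⟩
        k + 1
          ≡⟨ +-comm k 1 ⟩
        suc k ∎
        where
        open ≡-Reasoning
        new? : ∀ u v → Dec (u ≡ w′ × v ≡ w)
        new? u v = (u Fin.≟ w′) ×-dec (v Fin.≟ w)
        one : ∑[ u < n ] ∑[ v < n ] 𝟙 (new? u v) ≡ 1
        one = trans (sum-cong-≗ (λ u → trans (sum-cong-≗ (λ v → 𝟙-× (u Fin.≟ w′) (v Fin.≟ w)))
                (trans (sym (*-distribˡ-sum (𝟙 (u Fin.≟ w′)) (λ v → 𝟙 (v Fin.≟ w))))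
                  (trans (cong (𝟙 (u Fin.≟ w′) *_) (#-singleton w)) (*-identityʳ _)))))
                (#-singleton w′)
        disjoint : ∀ u v → Down u v × d w′ v < d w′ u → ¬ (u ≡ w′ × v ≡ w)
        disjoint u v (_ , lt) (refl , refl) = n≮0 (subst (d w′ w <_) (d-refl w′) lt)
        old : ∀ u v → Down u v × d w′ v < d w′ u → Down u v × d w v < d w u
        old u v (down@(u~v , c-lt) , lt) with closer-or-farther w u~v
        ... | inj₂ gt = down , gt
        ... | inj₁ lt′ with refl , refl ← flip-unique w′~w u~v lt lt′ =
          contradiction c-lt (<-asym (≤-reflexive dw′))
        fresh : ∀ u v → u ≡ w′ × v ≡ w → Down u v × d w v < d w u
        fresh u v (refl , refl) = (w′~w , ≤-reflexive dw′) ,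
          subst (_< d w w′) (sym (d-refl w)) (n≢0⇒n>0 (λ eq → ~-irrefl (subst (w′ ~_) (d≡0⇒≡ eq) w′~w)))
        cover : ∀ u v → Down u v × d w v < d w u → ¬ (Down u v × d w′ v < d w′ u) → u ≡ w′ × v ≡ w
        cover u v (down@(u~v , _) , lt) not with closer-or-farther w′ u~v
        ... | inj₂ gt = contradiction (down , gt) not
        ... | inj₁ lt′ with refl , refl ← flip-unique (~-sym w′~w) u~v lt lt′ = refl , refl

    -- Double counting of pairs of a vertex and an edge it turns: an edge from `u` down to `v` is
    -- turned by the `closer v u` vertices beyond it, and `w` turns `d c w` edges.
    closer-sum : ∑[ u < n ] ∑[ v < n ] (𝟙 (down? u v) * closer v u) ≡ status c
    closer-sum = begin
      ∑[ u < n ] ∑[ v < n ] (𝟙 (down? u v) * closer v u)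
        ≡⟨ sum₂-cong (λ u v → *-distribˡ-sum (𝟙 (down? u v)) (λ w → 𝟙 (d w v <? d w u))) ⟩
      ∑[ u < n ] ∑[ v < n ] ∑[ w < n ] (𝟙 (down? u v) * 𝟙 (d w v <? d w u))
        ≡⟨ sum₂-cong (λ u v → sum-cong-≗ (λ w → 𝟙-× (down? u v) (d w v <? d w u))) ⟨
      ∑[ u < n ] ∑[ v < n ] ∑[ w < n ] 𝟙 (turned? w u v)
        ≡⟨ sum-cong-≗ (λ u → ∑-comm (λ v w → 𝟙 (turned? w u v))) ⟩
      ∑[ u < n ] ∑[ w < n ] ∑[ v < n ] 𝟙 (turned? w u v)
        ≡⟨ ∑-comm (λ u w → ∑[ v < n ] 𝟙 (turned? w u v)) ⟩
      ∑[ w < n ] ∑[ u < n ] ∑[ v < n ] 𝟙 (turned? w u v)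
        ≡⟨ sum-cong-≗ #turned ⟩
      status c ∎
      where open ≡-Reasoning

    -- `Mo` orients each edge by the labels of its ends, here it is oriented away from `c`. As the
    -- summand is symmetric, twice either sum runs over both orientations.
    mostar : Mo G (IsTree.connected isTree) ≡
             ∑[ u < n ] ∑[ v < n ] (𝟙 (down? u v) * ∣ closer u v - closer v u ∣)
    mostar = trans
      (sum-cartesianProduct edge? (λ (u , v) → ∣ #closer G connected u v - #closer G connected v u ∣))
      (trans (sum₂-cong (λ u v → cong (𝟙 (edge? (u , v)) *_)
                                      (cong₂ ∣_-_∣ (#closer≡ u v) (#closer≡ v u))))
      (*-cancelˡ-≡ _ _ 2 (trans (orientation (λ u v → edge? (u , v)) edge-split imbalance imbalance-sym)
                           (sym (orientation down? down-split imbalance imbalance-sym)))))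
      where
      open IsTree isTree using (connected)
      imbalance : Fin n → Fin n → ℕ
      imbalance u v = ∣ closer u v - closer v u ∣
      imbalance-sym : ∀ u v → imbalance u v ≡ imbalance v u
      imbalance-sym u v = ∣-∣-comm (closer u v) (closer v u)
      edge? : ∀ ((u , v) : Fin n × Fin n) → Dec (u Fin.< v × u ~ v)
      edge? (u , v) = (u Fin.<? v) ×-dec (u ~? v)
      #closer≡ : ∀ u v → #closer G connected u v ≡ closer u v
      #closer≡ u v = count≡# (λ w → d w u <? d w v)
      edge-split : ∀ u v → 𝟙 (edge? (u , v)) + 𝟙 (edge? (v , u)) ≡ 𝟙 (u ~? v)
      edge-split u v = 𝟙-⊎ (edge? (u , v)) (edge? (v , u)) (u ~? v)
        (λ (lt , _) (gt , _) → <-asym lt gt) proj₂ (~-sym ∘ proj₂) either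
        where
        either : u ~ v → ¬ (u Fin.< v × u ~ v) → v Fin.< u × v ~ u
        either u~v not with Fin.<-cmp u v
        ... | tri< lt _ _ = contradiction (lt , u~v) not
        ... | tri≈ _ refl _ = contradiction u~v ~-irrefl
        ... | tri> _ _ gt = gt , ~-sym u~v

    private
      combined : ∑[ u < n ] ∑[ v < n ] (𝟙 (down? u v) * (∣ closer u v - closer v u ∣ + 2 * closer v u)) ≡
                 Mo G (IsTree.connected isTree) + 2 * status c
      combined = begin
        ∑[ u < n ] ∑[ v < n ] (𝟙 (down? u v) * (∣ closer u v - closer v u ∣ + 2 * closer v u))
          ≡⟨ sum₂-cong (λ u v → expand (𝟙 (down? u v)) ∣ closer u v - closer v u ∣ (closer v u)) ⟩
        ∑[ u < n ] ∑[ v < n ] (𝟙 (down? u v) * ∣ closer u v - closer v u ∣ + 2 * (𝟙 (down? u v) * closer v u))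
          ≡⟨ sum₂-+ (λ u v → 𝟙 (down? u v) * ∣ closer u v - closer v u ∣)
                    (λ u v → 2 * (𝟙 (down? u v) * closer v u)) ⟩
        ∑[ u < n ] ∑[ v < n ] (𝟙 (down? u v) * ∣ closer u v - closer v u ∣)
          + ∑[ u < n ] ∑[ v < n ] (2 * (𝟙 (down? u v) * closer v u))
          ≡⟨ cong₂ _+_ (sym mostar)
               (trans (sym (sum₂-* 2 (λ u v → 𝟙 (down? u v) * closer v u))) (cong (2 *_) closer-sum)) ⟩
        Mo G (IsTree.connected isTree) + 2 * status c ∎
        where
        open ≡-Reasoning
        expand : ∀ x y z → x * (y + 2 * z) ≡ x * y + 2 * (x * z)
        expand = solve-∀

      total : ∑[ u < n ] ∑[ v < n ] (𝟙 (down? u v) * n) ≡ (n ∸ 1) * n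
      total = begin
        ∑[ u < n ] ∑[ v < n ] (𝟙 (down? u v) * n)   ≡⟨ sum₂-cong (λ u v → *-comm (𝟙 (down? u v)) n) ⟩
        ∑[ u < n ] ∑[ v < n ] (n * 𝟙 (down? u v))   ≡⟨ sum₂-* n (λ u v → 𝟙 (down? u v)) ⟨
        n * ∑[ u < n ] ∑[ v < n ] 𝟙 (down? u v)     ≡⟨ cong (n *_) (cong pred #edges) ⟩
        n * (n ∸ 1)                                 ≡⟨ *-comm n (n ∸ 1) ⟩
        (n ∸ 1) * n                                 ∎
        where open ≡-Reasoning

    -- If the two sides of an edge have `a` and `b` vertices, then `n = a + b ≤ |a - b| + 2 b`.
    -- Taking for `b` the side away from `c`, the terms `b` add up to `status c`. Equality means
    -- that this side is the lighter one at every edge.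
    mostar-≥ : (n ∸ 1) * n ≤ Mo G (IsTree.connected isTree) + 2 * status c
    mostar-≥ = subst₂ _≤_ total combined (sum₂-mono λ u v → 𝟙-*-mono (down? u v) (bound u v ∘ proj₁))
      where
      open ≤-Reasoning
      bound : ∀ u v → u ~ v → n ≤ ∣ closer u v - closer v u ∣ + 2 * closer v u
      bound u v u~v = begin
        n                                                        ≡⟨ closer-+ u~v ⟨
        closer u v + closer v u
          ≤⟨ +-monoˡ-≤ (closer v u) (m≤∣m-n∣+n (closer u v) (closer v u)) ⟩
        ∣ closer u v - closer v u ∣ + closer v u + closer v u
          ≡⟨ +-assoc ∣ closer u v - closer v u ∣ _ _ ⟩
        ∣ closer u v - closer v u ∣ + (closer v u + closer v u)
          ≡⟨ cong (λ x → ∣ closer u v - closer v u ∣ + (closer v u + x))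
                  (+-identityʳ (closer v u)) ⟨
        ∣ closer u v - closer v u ∣ + 2 * closer v u             ∎

    Central : Set
    Central = ∀ u → status c ≤ status u

    module _ (central : Central) where

      -- Moving from `c` to a neighbour `v` changes the status by `closer c v` minus `closer v c`,
      -- which is not negative at a central `c`. Farther down, the side beyond an edge lies inside
      -- the side beyond the edge above it, and the opposite sides grow accordingly.
      light : ∀ {u v} → Down u v → closer v u ≤ closer u v
      light {u} down = go (d c u) down refl
        where
        open ≤-Reasoning
        atRoot : ∀ {u v} → u ≡ c → u ~ v → closer v u ≤ closer u v
        atRoot {v = v} refl u~v = +-cancelˡ-≤ (status c) _ _ (begin
          status c + closer v c                        ≤⟨ +-monoˡ-≤ _ (central v) ⟩
          status v + closer v c                        ≡⟨ ∑-distrib-+ (d v) (λ w → 𝟙 (d w v <? d w c)) ⟨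
          ∑[ w < n ] (d v w + 𝟙 (d w v <? d w c))      ≡⟨ sum-cong-≗ shift ⟩
          ∑[ w < n ] (d c w + 𝟙 (d w c <? d w v))      ≡⟨ ∑-distrib-+ (d c) (λ w → 𝟙 (d w c <? d w v)) ⟩
          status c + closer c v                        ∎)
          where
          shift : ∀ w → d v w + 𝟙 (d w v <? d w c) ≡ d c w + 𝟙 (d w c <? d w v)
          shift w rewrite d-sym v w | d-sym c w with closer-or-farther w u~v
          ... | inj₁ lt = trans (cong (d w v +_) (𝟙-no (d w v <? d w c) (<-asym lt)))
            (trans (trans (+-identityʳ _) (trans (sym (d-closer w u~v lt)) (+-comm 1 _)))
                   (cong (d w c +_) (sym (𝟙-yes (d w c <? d w v) lt))))
          ... | inj₂ gt = trans (cong (d w v +_) (𝟙-yes (d w v <? d w c) gt))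
            (trans (trans (+-comm _ 1) (trans (d-closer w (~-sym u~v) gt) (sym (+-identityʳ _))))
                   (cong (d w c +_) (sym (𝟙-no (d w c <? d w v) (<-asym gt)))))

        go : ∀ k {u v} → Down u v → d c u ≡ k → closer v u ≤ closer u v
        go zero    (u~v , _) du = atRoot (sym (d≡0⇒≡ du)) u~v
        go (suc k) {u} {v} (u~v , lt) du
          with g , g~u , dg ← closerNeighbour {c} {u} (λ { refl → 0≢1+n (trans (sym (d-refl c)) du) }) = begin
          closer v u  ≤⟨ sum-mono (λ w → 𝟙-mono (d w v <? d w u) (d w u <? d w g) (beyond w)) ⟩
          closer u g  ≤⟨ go k (g~u , ≤-reflexive dg) (suc-injective (trans dg du)) ⟩
          closer g u  ≤⟨ sum-mono (λ w → 𝟙-mono (d w g <? d w u) (d w u <? d w v) (before w)) ⟩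
          closer u v  ∎
          where
          g≢v : g ≢ v
          g≢v refl = <-asym lt (≤-reflexive dg)
          beyond : ∀ w → d w v < d w u → d w u < d w g
          beyond w v<u with closer-or-farther w g~u
          ... | inj₂ u<g = u<g
          ... | inj₁ g<u = contradiction (closer-unique w g~u (~-sym u~v) g<u v<u) g≢v
          before : ∀ w → d w g < d w u → d w u < d w v
          before w g<u with closer-or-farther w u~v
          ... | inj₁ u<v = u<v
          ... | inj₂ v<u = contradiction (closer-unique w g~u (~-sym u~v) g<u v<u) g≢v

      mostar-≡ : Mo G (IsTree.connected isTree) + 2 * status c ≡ (n ∸ 1) * n
      mostar-≡ = trans (sym combined)
        (trans (sum₂-cong λ u v → 𝟙-*-cong (down? u v) (balance u v)) total)
        where
        open ≡-Reasoning
        balance : ∀ u v → Down u v → ∣ closer u v - closer v u ∣ + 2 * closer v u ≡ n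
        balance u v down = begin
          ∣ closer u v - closer v u ∣ + 2 * closer v u
            ≡⟨ cong (_+ 2 * closer v u)
                 (trans (∣-∣-comm (closer u v) (closer v u)) (m≤n⇒∣m-n∣≡n∸m (light down))) ⟩
          closer u v ∸ closer v u + 2 * closer v u
            ≡⟨ cong (λ x → closer u v ∸ closer v u + (closer v u + x)) (+-identityʳ (closer v u)) ⟩
          closer u v ∸ closer v u + (closer v u + closer v u)
            ≡⟨ +-assoc (closer u v ∸ closer v u) _ _ ⟨
          closer u v ∸ closer v u + closer v u + closer v u
            ≡⟨ cong (_+ closer v u) (m∸n+n≡m (light down)) ⟩
          closer u v + closer v u
            ≡⟨ closer-+ (proj₁ down) ⟩
          n ∎

  centre-exists : Fin n → ∃[ c ] (∀ u → status c ≤ status u)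
  centre-exists v with least (λ k → any? (λ c → status c ≟ k)) (status v) (v , refl)
  ... | _ , (c , refl) , minimal = c , λ u → minimal (status u) (u , refl)

-- Depths, leaves and levels of a rooted tree.

module Levels {n : ℕ} (G : SimpleGraph (Fin n)) (isTree : IsTree G) (c : Fin n) where
  open SimpleGraph G
  open Mostar G isTree public
  open Rooted c public

  depth : Fin n → ℕ
  depth = d c

  depth-≢ : ∀ {v k} → depth v ≡ suc k → v ≢ c
  depth-≢ dv refl = 0≢1+n (trans (sym (d-refl c)) dv)

  -- The root is its own parent.
  parent : Fin n → Fin n
  parent v with v Fin.≟ c
  ... | yes _   = c
  ... | no  v≢c = proj₁ (closerNeighbour v≢c)

  depth-parent : ∀ v → depth (parent v) ≡ pred (depth v)
  depth-parent v with v Fin.≟ c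
  ... | yes refl = trans (d-refl c) (cong pred (sym (d-refl c)))
  ... | no  v≢c  = cong pred (proj₂ (proj₂ (closerNeighbour v≢c)))

  parent-down : ∀ {v} → v ≢ c → Down (parent v) v
  parent-down {v} v≢c with v Fin.≟ c
  ... | yes v≡c  = contradiction v≡c v≢c
  ... | no  v≢c′ with closerNeighbour v≢c′
  ...   | p , p~v , dp = p~v , ≤-reflexive dp

  down⇒parent : ∀ {u v} → Down u v → parent v ≡ u
  down⇒parent {u} {v} (u~v , lt) = closer-unique c (proj₁ down) u~v (proj₂ down) lt
    where
    down : Down (parent v) v
    down = parent-down λ { refl → n≮0 (subst (depth u <_) (d-refl c) lt) }

  down-depth : ∀ {u v} → Down u v → depth v ≡ suc (depth u)
  down-depth (u~v , lt) = sym (d-closer c u~v lt)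

  climb : ℕ → Fin n → Fin n
  climb zero    v = v
  climb (suc k) v = parent (climb k v)

  depth-climb : ∀ k v → depth (climb k v) ≡ depth v ∸ k
  depth-climb zero    v = refl
  depth-climb (suc k) v = trans (depth-parent (climb k v))
    (trans (cong pred (depth-climb k v)) (pred[m∸n]≡m∸[1+n] (depth v) k))

  -- Indexed by the depth of the ancestor instead of the number of steps up to it, so that a leaf
  -- and the vertices above it can be compared at a common level. A vertex of depth less than `k` is
  -- its own ancestor here.
  ancestor : ℕ → Fin n → Fin n
  ancestor k v = climb (depth v ∸ k) v

  ancestor-self : ∀ {k v} → depth v ≡ k → ancestor k v ≡ v
  ancestor-self {k} {v} refl = cong (λ i → climb i v) (n∸n≡0 k)

  -- A vertex other than the root that is not a leaf has a neighbour besides its parent, and this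
  -- lies deeper. The descent ends because no depth exceeds their sum `status c`, which serves as
  -- fuel.
  leafBelow : ∀ v → v ≢ c → ∃[ w ] (degree G w ≡ 1 × depth v ≤ depth w × ancestor (depth v) w ≡ v)
  leafBelow v = go (status c) v (m≤m+n _ _)
    where
    go : ∀ fuel v → status c ≤ fuel + depth v → v ≢ c →
         ∃[ w ] (degree G w ≡ 1 × depth v ≤ depth w × ancestor (depth v) w ≡ v)
    go fuel v enough v≢c with degree G v ≟ 1
    ... | yes leaf = v , leaf , ≤-refl , ancestor-self refl
    ... | no  ¬leaf with #-other (v ~?_)
             (≤∧≢⇒< positive (λ eq → ¬leaf (trans (degree≡# v) (sym eq)))) (parent v)
      where
      positive : 1 ≤ # (v ~?_)
      positive = #-positive (v ~?_) (parent v) (~-sym (proj₁ (parent-down v≢c)))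
    ... | x , v~x , x≢parent with closer-or-farther c v~x
    ...   | inj₂ x<v = contradiction (sym (down⇒parent (~-sym v~x , x<v))) x≢parent
    ...   | inj₁ v<x with fuel
    ...     | zero = contradiction (≤-trans (term≤sum depth x) enough) (<⇒≱ v<x)
    ...     | suc fuel′ with go fuel′ x
                (≤-trans enough
                  (≤-trans (≤-reflexive (sym (+-suc fuel′ (depth v)))) (+-monoʳ-≤ fuel′ v<x)))
                (λ { refl → n≮0 (subst (depth v <_) (d-refl c) v<x) })
    ...       | w , leaf , x≤w , w-x = w , leaf , <⇒≤ (<-≤-trans v<x x≤w) , above
      where
      above : ancestor (depth v) w ≡ v
      above = begin
        climb (depth w ∸ depth v) w            ≡⟨ cong (λ k → climb k w) (suc-∸ (<-≤-trans v<x x≤w)) ⟩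
        parent (climb (depth w ∸ suc (depth v)) w)
          ≡⟨ cong (λ k → parent (climb (depth w ∸ k) w)) (d-closer c v~x v<x) ⟩
        parent (climb (depth w ∸ depth x) w)   ≡⟨ cong parent w-x ⟩
        parent x                               ≡⟨ down⇒parent (v~x , v<x) ⟩
        v                                      ∎
        where
        open ≡-Reasoning
        suc-∸ : ∀ {m n} → n < m → m ∸ n ≡ suc (m ∸ suc n)
        suc-∸ {suc m} {n} (s≤s n≤m) = +-∸-assoc 1 n≤m

  leaf? : ∀ v → Dec (degree G v ≡ 1)
  leaf? v = degree G v ≟ 1

  level : ℕ → ℕ
  level k = # (λ w → depth w ≟ k)

  ball : ℕ → ℕ
  ball k = # (λ w → depth w ≤? k)

  -- By `leafBelow`, sending a leaf to its ancestor at depth `suc k` covers that level.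
  level≤leaves : ∀ k → level (suc k) ≤ # leaf?
  level≤leaves k = #-surjection (λ w → depth w ≟ suc k) leaf? (ancestor (suc k)) lift
    where
    lift : ∀ v → depth v ≡ suc k → ∃[ w ] (degree G w ≡ 1 × ancestor (suc k) w ≡ v)
    lift v dv with w , leaf , _ , w-v ← leafBelow v (depth-≢ dv) =
      w , leaf , trans (cong (λ i → ancestor i w) (sym dv)) w-v

  ball-zero : ball 0 ≡ 1
  ball-zero = #-unique (λ w → depth w ≤? 0) c
    (≤-reflexive (d-refl c)) (λ w dw → sym (d≡0⇒≡ (n≤0⇒n≡0 dw)))

  ball-suc : ∀ k → ball (suc k) ≡ ball k + level (suc k)
  ball-suc k = trans
    (sum-cong-≗ (λ w → sym (𝟙-⊎ (depth w ≤? k) (depth w ≟ suc k) (depth w ≤? suc k)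
      (λ le eq → 1+n≰n (≤-trans (≤-reflexive (sym eq)) le)) m≤n⇒m≤1+n ≤-reflexive
      (λ le nle → ≤-antisym le (≰⇒> nle)))))
    (∑-distrib-+ (λ w → 𝟙 (depth w ≤? k)) (λ w → 𝟙 (depth w ≟ suc k)))

  degree-root : degree G c ≡ level 1
  degree-root = trans (degree≡# c) (#-cong (c ~?_) (λ w → depth w ≟ 1) to from)
    where
    to : ∀ v → c ~ v → depth v ≡ 1
    to v c~v = trans (down-depth (c~v , subst (_< depth v) (sym (d-refl c)) (n≢0⇒n>0 v≢c)))
                     (cong suc (d-refl c))
      where
      v≢c : depth v ≢ 0
      v≢c eq = ~-irrefl (subst (c ~_) (sym (d≡0⇒≡ eq)) c~v)
    from : ∀ v → depth v ≡ 1 → c ~ v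
    from v dv = subst (_~ v) (sym (d≡0⇒≡ (trans (depth-parent v) (cong pred dv))))
                      (proj₁ (parent-down (depth-≢ dv)))

  -- A vertex at depth `d` lies in `m ∸ d` of the first `m` balls. This is the layer formula for the
  -- status, cut at `m` and written without subtraction.
  layers : ∀ m → status c + ∑[ k < m ] ball (toℕ k) ≡ ∑[ w < n ] (depth w + (m ∸ depth w))
  layers m = begin
    status c + ∑[ k < m ] ball (toℕ k)
      ≡⟨ cong (status c +_) (∑-comm {m} (λ k w → 𝟙 (depth w ≤? toℕ k))) ⟩
    status c + ∑[ w < n ] ∑[ k < m ] 𝟙 (depth w ≤? toℕ k)
      ≡⟨ cong (status c +_) (sum-cong-≗ (λ w → sum-below m (depth w))) ⟩
    status c + ∑[ w < n ] (m ∸ depth w)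
      ≡⟨ ∑-distrib-+ depth (λ w → m ∸ depth w) ⟨
    ∑[ w < n ] (depth w + (m ∸ depth w)) ∎
    where open ≡-Reasoning

  -- At depth `d` a vertex contributes `d + (m ∸ d)`, which is at least `m`, with equality exactly
  -- when `d ≤ m`. The next two lemmas are the two directions of the equality case.
  layers-≥ : ∀ m → n * m ≤ status c + ∑[ k < m ] ball (toℕ k)
  layers-≥ m = subst₂ _≤_ (sum-const n m) (sym (layers m)) (sum-mono (λ w → m≤n+m∸n m (depth w)))

  shallow⇒layers-≡ : ∀ m → (∀ w → depth w ≤ m) → status c + ∑[ k < m ] ball (toℕ k) ≡ n * m
  shallow⇒layers-≡ m shallow =
    trans (layers m) (trans (sum-cong-≗ (λ w → m+[n∸m]≡n (shallow w))) (sum-const n m))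

  layers-≤⇒shallow : ∀ m → status c + ∑[ k < m ] ball (toℕ k) ≤ n * m → ∀ w → depth w ≤ m
  layers-≤⇒shallow m le w = subst (depth w ≤_) (sym tight) (m≤m+n _ _)
    where
    tight : m ≡ depth w + (m ∸ depth w)
    tight = sum-tight (λ w → m≤n+m∸n m (depth w))
              (subst₂ _≤_ (layers m) (sym (sum-const n m)) le) w

-- The competing tree: a spider given by its parent function.

module ParentFunction {V : Set} (G : SimpleGraph V) (parent : V → V) (height : V → ℕ)
  (towards : ∀ {u v} → SimpleGraph._~_ G u v →
    (u ≡ parent v × height u < height v) ⊎ (v ≡ parent u × height v < height u)) where
  open SimpleGraph G

  -- A path that does not begin with a step to the parent never takes one.
  ascending : ∀ {k u v} (p : Walk G k u v) → Unique (walkVertices G p) →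
              parent u ∉ walkVertices G p → height u ≤ height v
  ascending stop _ _ = ≤-refl
  ascending (step u~w p) (u∉ ∷ distinct) up with towards u~w
  ... | inj₁ (refl , lt) = ≤-trans (<⇒≤ lt) (ascending p distinct (λ u∈ → All.lookup u∉ u∈ refl))
  ... | inj₂ (refl , _)  = contradiction (there (start∈ G p)) up

  strictlyAscending : ∀ {k u v} (p : Walk G (suc k) u v) → Unique (walkVertices G p) →
                      parent u ∉ walkVertices G p → height u < height v
  strictlyAscending (step u~w p) (u∉ ∷ distinct) up with towards u~w
  ... | inj₁ (refl , lt) = <-≤-trans lt (ascending p distinct (λ u∈ → All.lookup u∉ u∈ refl))
  ... | inj₂ (refl , _)  = contradiction (there (start∈ G p)) up

  descending : ∀ {k u v} (p : Walk G k u v) → Unique (walkVertices G p) →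
               parent v ∉ walkVertices G p → height v ≤ height u
  descending stop _ _ = ≤-refl
  descending (step u~w p) (u∉ ∷ distinct) down with towards u~w
  ... | inj₂ (refl , lt) = ≤-trans (descending p distinct (down ∘ there)) (<⇒≤ lt)
  descending (step u~w stop) (u∉ ∷ distinct) down | inj₁ (refl , lt) = contradiction (here refl) down
  -- After a first step from a parent to its child the rest would ascend strictly, against the
  -- induction hypothesis.
  descending (step u~w p@(step _ _)) (u∉ ∷ distinct) down | inj₁ (refl , lt) =
    contradiction (descending p distinct (down ∘ there))
      (<⇒≱ (strictlyAscending p distinct (λ u∈ → All.lookup u∉ u∈ refl)))

  -- If both cycle neighbours of the start `u` are its parent, they coincide. Otherwise `u` is the
  -- parent of an end of the remaining path and does not occur on it. The ascent and descent lemmas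
  -- then compare the heights of the two ends in a way that contradicts the edges at `u` or, when
  -- `u` is the parent of both ends, each other.
  acyclic : ¬ Cycle G
  acyclic record { path = step u~w p@(step _ p′) ; distinct = u∉ ∷ distinct@(w∉ ∷ _) ; closing = v~u }
    with towards v~u | towards u~w
  ... | inj₁ (v≡ , lt) | inj₂ (w≡ , _) = All.lookup w∉ (end∈ G p′) (trans w≡ (sym v≡))
  ... | inj₁ (_ , v<u) | inj₁ (refl , u<w) =
    contradiction (strictlyAscending p distinct (λ u∈ → All.lookup u∉ u∈ refl))
      (<-asym (<-trans v<u u<w))
  ... | inj₂ (refl , u<v) | inj₁ (u≡ , _) =
    contradiction (descending p distinct (λ u∈ → All.lookup u∉ u∈ refl))
      (<⇒≱ (strictlyAscending p distinct (λ u∈ → All.lookup u∉ u∈ u≡)))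
  ... | inj₂ (refl , u<v) | inj₂ (_ , w<u) =
    contradiction (descending p distinct (λ u∈ → All.lookup u∉ u∈ refl)) (<⇒≱ (<-trans w<u u<v))

-- The spider S n r on the vertices 0, …, n − 1: the centre is 0, and the
-- vertex at distance k from it on leg i is (k − 1) r + i + 1, so that the
-- parent of a vertex is found by subtracting r.
module BalancedSpider (r′ t : ℕ) where
  -- The condition `t ≤ n - 4` says that `r = n - t - 1` is at least 3.
  r N : ℕ
  r = 3 + r′
  N = suc (r + t)

  parent : Fin N → Fin N
  parent v = Fin.fromℕ< (≤-<-trans (m∸n≤m (toℕ v) r) (Fin.toℕ<n v))

  toℕ-parent : ∀ v → toℕ (parent v) ≡ toℕ v ∸ r
  toℕ-parent v = Fin.toℕ-fromℕ< _

  -- Truncated subtraction gives `1, …, r` the parent `0`, and also makes `0` its own parent; the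
  -- strict inequality removes that loop.
  Arc : Fin N → Fin N → Set
  Arc u v = u ≡ parent v × toℕ u < toℕ v

  arc? : ∀ u v → Dec (Arc u v)
  arc? u v = (u Fin.≟ parent v) ×-dec (toℕ u <? toℕ v)

  arc-parent : ∀ v → 0 < toℕ v → Arc (parent v) v
  arc-parent (suc v) _ = refl ,
    subst (_< suc (toℕ v)) (sym (toℕ-parent (suc v))) (s≤s (m∸n≤m (toℕ v) (2 + r′)))

  graph : SimpleGraph (Fin N)
  graph = record
    { _~_      = λ u v → Arc u v ⊎ Arc v u
    ; _~?_     = λ u v → arc? u v ⊎-dec arc? v u
    ; ~-sym    = λ { (inj₁ a) → inj₂ a ; (inj₂ a) → inj₁ a }
    ; ~-irrefl = λ { (inj₁ (_ , lt)) → <-irrefl refl lt ; (inj₂ (_ , lt)) → <-irrefl refl lt }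
    }
  open SimpleGraph graph

  walkToCentre : ∀ k v → toℕ v ≤ k * r → ∃[ j ] (j ≤ k × Walk graph j v zero)
  walkToCentre k       zero    _ = 0 , z≤n , stop
  walkToCentre (suc k) (suc v) le
    with j , j≤k , p ← walkToCentre k (parent (suc v))
                         (subst (_≤ k * r) (sym (toℕ-parent (suc v))) (m≤n+o⇒m∸n≤o (suc (toℕ v)) r le))
    = suc j , s≤s j≤k , step (inj₂ (arc-parent (suc v) z<s)) p

  connected : Connected graph
  connected u v with walkToCentre (toℕ u) u (m≤m*n (toℕ u) r) | walkToCentre (toℕ v) v (m≤m*n (toℕ v) r)
  ... | _ , _ , p | _ , _ , q = _ , append graph p (reverse graph q)

  isTree : IsTree graph
  isTree = record
    { connected = connected
    ; acyclic   = ParentFunction.acyclic graph parent toℕ id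
    }

  open Levels graph isTree zero using (depth; ball; d-min; d-sym; degree≡#; status; shallow⇒layers-≡)

  -- The spider's status is to be bounded from above, and so are its depths: each step to the parent
  -- subtracts `r`.
  depth-≤ : ∀ k v → toℕ v ≤ k * r → depth v ≤ k
  depth-≤ k v le with j , j≤k , p ← walkToCentre k v le =
    ≤-trans (subst (_≤ j) (d-sym v zero) (d-min p)) j≤k

  -- Keeps the centre out of the vertices of degree two.
  degree-centre : 3 ≤ degree graph zero
  degree-centre = subst (3 ≤_) (sym (degree≡# zero)) (#-three (zero ~?_)
    {suc zero} {suc (suc zero)} {suc (suc (suc zero))}
    (attached (s≤s z≤n) z<s) (attached (s≤s (s≤s z≤n)) z<s) (attached (s≤s (s≤s (s≤s z≤n))) z<s)
    (λ ()) (λ ()) (λ ()))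
    where
    attached : ∀ {v} → toℕ v ≤ r → 0 < toℕ v → zero ~ v
    attached {v} v≤r 0<v = inj₁ (Fin.toℕ-injective (sym (trans (toℕ-parent v) (m≤n⇒m∸n≡0 v≤r))) , 0<v)

  -- Besides its parent, `v` has the neighbour `v + r` if this is still a label, that is, at most
  -- `r + t`.
  degree-leg : ∀ v → 0 < toℕ v → degree graph v ≡ 1 + 𝟙 (toℕ v <? suc t)
  degree-leg v 0<v = begin
    degree graph v                             ≡⟨ degree≡# v ⟩
    # (v ~?_)                                  ≡⟨ sum-cong-≗ (λ u → sym (𝟙-⊎ (arc? u v) (arc? v u) (v ~? u)
                                                  (λ (_ , lt) (_ , gt) → <-asym lt gt) inj₂ inj₁ other)) ⟩
    ∑[ u < N ] (𝟙 (arc? u v) + 𝟙 (arc? v u))   ≡⟨ ∑-distrib-+ (λ u → 𝟙 (arc? u v)) (λ u → 𝟙 (arc? v u)) ⟩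
    # (λ u → arc? u v) + # (arc? v)
      ≡⟨ cong₂ _+_ (#-unique (λ u → arc? u v) (parent v) (arc-parent v 0<v) (λ _ → proj₁))
                     next ⟩
    1 + 𝟙 (toℕ v <? suc t)                     ∎
    where
    open ≡-Reasoning
    other : ∀ {u} → v ~ u → ¬ Arc u v → Arc v u
    other (inj₁ a) _ = a
    other (inj₂ a) n = contradiction a n
    arc⇒+ : ∀ {u} → Arc v u → toℕ u ≡ toℕ v + r
    arc⇒+ {u} (v≡ , lt) = begin
      toℕ u
        ≡⟨ m∸n+n≡m {toℕ u} {r} (<⇒≤ (m∸n≢0⇒n<m u∸r≢0)) ⟨
      toℕ u ∸ r + r  ≡⟨ cong (_+ r) (toℕ-parent u) ⟨
      toℕ (parent u) + r ≡⟨ cong (λ x → toℕ x + r) v≡ ⟨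
      toℕ v + r      ∎
      where
      u∸r≢0 : toℕ u ∸ r ≢ 0
      u∸r≢0 eq = <-irrefl (sym (trans (cong toℕ v≡) (trans (toℕ-parent u) eq))) 0<v
    next : # (arc? v) ≡ 𝟙 (toℕ v <? suc t)
    next = go (toℕ v <? suc t)
      where
      go : (v<? : Dec (toℕ v < suc t)) → # (arc? v) ≡ 𝟙 v<?
      go (yes (s≤s v≤t)) = #-unique (arc? v) u
        ( Fin.toℕ-injective (sym (trans (toℕ-parent u)
            (trans (cong (_∸ r) (Fin.toℕ-fromℕ< v+r<N)) (m+n∸n≡m (toℕ v) r))))
        , subst (toℕ v <_) (sym (Fin.toℕ-fromℕ< v+r<N)) (m<m+n (toℕ v) z<s))
        (λ x arc → Fin.toℕ-injective (trans (arc⇒+ arc) (sym (Fin.toℕ-fromℕ< v+r<N))))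
        where
        v+r<N : toℕ v + r < N
        v+r<N = s≤s (subst (toℕ v + r ≤_) (+-comm t r) (+-monoˡ-≤ r v≤t))
        u = Fin.fromℕ< v+r<N
      go (no v≰t) = #-none (arc? v) λ u arc → v≰t (s≤s (+-cancelʳ-≤ r (toℕ v) t
        (subst₂ _≤_ (arc⇒+ arc) (+-comm r t) (s≤s⁻¹ (Fin.toℕ<n u)))))

  -- Together with the centre, the vertices of degree two are the labels `0, …, t`.
  degreeTwo : #degreeTwo graph ≡ t
  degreeTwo = suc-injective (begin
    suc (#degreeTwo graph)                                          ≡⟨ cong suc (count≡# two?) ⟩
    suc (# two?)                                                    ≡⟨ +-comm 1 (# two?) ⟩
    # two? + 1
      ≡⟨ cong (# two? +_) (#-singleton {N} zero) ⟨
    # two? + # {N} (Fin._≟ zero)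
      ≡⟨ ∑-distrib-+ {N} (𝟙 ∘ two?) (λ v → 𝟙 (v Fin.≟ zero)) ⟨
    ∑[ v < N ] (𝟙 (two? v) + 𝟙 (v Fin.≟ zero))                      ≡⟨ sum-cong-≗ pointwise ⟩
    # (λ v → toℕ {N} v <? suc t)
      ≡⟨ #-initial N (suc t) (s≤s (m≤n+m t r)) ⟩
    suc t                                                           ∎)
    where
    open ≡-Reasoning
    two? : ∀ v → Dec (degree graph v ≡ 2)
    two? v = degree graph v ≟ 2
    pointwise : ∀ v → 𝟙 (two? v) + 𝟙 (v Fin.≟ zero) ≡ 𝟙 (toℕ v <? suc t)
    pointwise zero    = cong (_+ 1) (𝟙-no (two? zero) (λ eq → 1+n≰n (subst (3 ≤_) eq degree-centre)))
    pointwise (suc v) = trans (+-identityʳ _) (𝟙-cong (two? (suc v)) (toℕ (suc v) <? suc t) to from)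
      where
      deg : degree graph (suc v) ≡ 1 + 𝟙 (toℕ (suc v) <? suc t)
      deg = degree-leg (suc v) z<s
      to : degree graph (suc v) ≡ 2 → toℕ (suc v) < suc t
      to eq = decidable-stable (toℕ (suc v) <? suc t) λ v≮ →
        0≢1+n (suc-injective (trans (sym (trans deg (cong suc (𝟙-no (toℕ (suc v) <? suc t) v≮)))) eq))
      from : toℕ (suc v) < suc t → degree graph (suc v) ≡ 2
      from v< = trans deg (cong suc (𝟙-yes (toℕ (suc v) <? suc t) v<))

  spider∈𝓔 : 𝓔 N t
  spider∈𝓔 = record { graph = graph ; isTree = isTree ; degreeTwo = degreeTwo }

  -- All depths are at most `suc q`, so the layer formula is exact there, and the labels `0, …, k r`
  -- lie within distance `k` of the centre.
  status-≤ : ∀ q → q * r ≤ r + t → r + t ≤ suc q * r →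
             status zero + ∑[ k < suc q ] suc (toℕ k * r) ≤ N * suc q
  status-≤ q lower upper = ≤-trans
    (+-monoʳ-≤ (status zero) (sum-mono large))
    (≤-reflexive (shallow⇒layers-≡ (suc q)
      (λ v → depth-≤ (suc q) v (≤-trans (s≤s⁻¹ (Fin.toℕ<n v)) upper))))
    where
    large : ∀ (k : Fin (suc q)) → suc (toℕ k * r) ≤ ball (toℕ k)
    large k = subst (_≤ ball (toℕ k))
      (#-initial N (suc (toℕ k * r)) (s≤s (≤-trans (*-monoˡ-≤ r (s≤s⁻¹ (Fin.toℕ<n k))) lower)))
      (sum-mono λ v → 𝟙-mono (toℕ {N} v <? suc (toℕ k * r)) (depth v ≤? toℕ k)
        (depth-≤ (toℕ k) v ∘ s≤s⁻¹))

-- The equality case. Maximality enters as `status-≤`, the spider's bound carried over to `c`.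

module Extremal {n r t : ℕ} .{{_ : NonZero r}} (n≡ : n ≡ suc (r + t)) (3≤r : 3 ≤ r)
  (graph : SimpleGraph (Fin n)) (isTree : IsTree graph) (degreeTwo : #degreeTwo graph ≡ t) (c : Fin n)
  (status-≤ : ∀ q → q * r ≤ r + t → r + t ≤ suc q * r →
              Mostar.status graph isTree c + ∑[ k < suc q ] suc (toℕ k * r) ≤ n * suc q)
  where
  open SimpleGraph graph
  open Levels graph isTree c

  q s : ℕ
  q = (r + t) / r
  s = r + t ∸ r * q

  q*r≤ : q * r ≤ r + t
  q*r≤ = m/n*n≤m (r + t) r

  ≤[1+q]*r : r + t ≤ suc q * r
  ≤[1+q]*r = begin
    r + t                ≡⟨ m≡m%n+[m/n]*n (r + t) r ⟩
    (r + t) % r + q * r  ≤⟨ +-monoˡ-≤ (q * r) (<⇒≤ (m%n<n (r + t) r)) ⟩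
    suc q * r            ∎
    where open ≤-Reasoning

  r*q+s : r * q + s ≡ r + t
  r*q+s = m+[n∸m]≡n (subst (_≤ r + t) (*-comm q r) q*r≤)

  0<q : 0 < q
  0<q = m≥n⇒m/n>0 (m≤m+n r t)

  two? : ∀ v → Dec (degree graph v ≡ 2)
  two? v = degree graph v ≟ 2

  #two : # two? ≡ t
  #two = trans (sym (count≡# two?)) degreeTwo

  -- Otherwise all degrees would be 1 or 2, leaving only the path.
  #leaves≤r : # leaf? ≤ r
  #leaves≤r = ≮⇒≥ λ r<leaves →
    let open ≡-Reasoning
        tight : ∀ v → 𝟙 (leaf? v) + 𝟙 (two? v) ≡ 1
        tight = sum-tight atMostOne (covered r<leaves)
        degrees : ∑[ v < n ] degree graph v ≡ n + t
        degrees = begin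
          ∑[ v < n ] degree graph v                  ≡⟨ sum-cong-≗ (λ v → degree-tight v (tight v)) ⟩
          ∑[ v < n ] (1 + 𝟙 (two? v))                ≡⟨ ∑-distrib-+ (λ _ → 1) (𝟙 ∘ two?) ⟩
          ∑[ v < n ] 1 + # two?
            ≡⟨ cong₂ _+_ (trans (sum-const n 1) (*-identityʳ n)) #two ⟩
          n + t                                      ∎
        -- A degree sum of both `n + t` and `2 n - 2` means `n = t + 2`, as for a path.
        twice : 2 + t ≡ n
        twice = +-cancelˡ-≡ n _ _ (begin
          n + (2 + t)                                ≡⟨ +-comm n (2 + t) ⟩
          2 + t + n                                  ≡⟨ cong (2 +_) (trans (+-comm t n) (sym degrees)) ⟩
          2 + ∑[ v < n ] degree graph v              ≡⟨ degree-sum ⟩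
          2 * n                                      ≡⟨ cong (n +_) (+-identityʳ n) ⟩
          n + n                                      ∎)
    in <-irrefl (trans twice n≡) (s≤s (+-monoˡ-≤ t {2} {r} (≤-trans (n≤1+n 2) 3≤r)))
    where
    atMostOne : ∀ v → 𝟙 (leaf? v) + 𝟙 (two? v) ≤ 1
    atMostOne v with degree graph v
    ... | 0 = z≤n
    ... | 1 = ≤-refl
    ... | 2 = ≤-refl
    ... | suc (suc (suc _)) = z≤n
    degree-tight : ∀ v → 𝟙 (leaf? v) + 𝟙 (two? v) ≡ 1 → degree graph v ≡ 1 + 𝟙 (two? v)
    degree-tight v with degree graph v
    ... | 0 = λ ()
    ... | 1 = λ _ → refl
    ... | 2 = λ _ → refl
    ... | suc (suc (suc _)) = λ ()
    covered : r < # leaf? → ∑[ v < n ] 1 ≤ ∑[ v < n ] (𝟙 (leaf? v) + 𝟙 (two? v))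
    covered r<leaves = begin
      ∑[ v < n ] 1                               ≡⟨ trans (sum-const n 1) (*-identityʳ n) ⟩
      n                                          ≡⟨ n≡ ⟩
      suc r + t                                  ≤⟨ +-monoˡ-≤ t r<leaves ⟩
      # leaf? + t                                ≡⟨ cong (# leaf? +_) #two ⟨
      # leaf? + # two?                           ≡⟨ ∑-distrib-+ (𝟙 ∘ leaf?) (𝟙 ∘ two?) ⟨
      ∑[ v < n ] (𝟙 (leaf? v) + 𝟙 (two? v))      ∎
      where open ≤-Reasoning

  ball≤ : ∀ k → ball k ≤ suc (k * r)
  ball≤ zero    = ≤-reflexive ball-zero
  ball≤ (suc k) = begin
    ball (suc k)            ≡⟨ ball-suc k ⟩
    ball k + level (suc k)  ≤⟨ +-mono-≤ (ball≤ k) (≤-trans (level≤leaves k) #leaves≤r) ⟩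
    suc (k * r) + r         ≡⟨ cong suc (+-comm (k * r) r) ⟩
    suc (suc k * r)         ∎
    where open ≤-Reasoning

  full : ℕ
  full = ∑[ k < suc q ] suc (toℕ k * r)

  balls≤full : ∑[ k < suc q ] ball (toℕ k) ≤ full
  balls≤full = sum-mono {suc q} (λ k → ball≤ (toℕ k))

  -- `layers-≥` and `status-≤` bound the sum of the balls from below by `full`, while `ball≤` bounds
  -- each term from above.
  ball-full : ∀ (k : Fin (suc q)) → ball (toℕ k) ≡ suc (toℕ k * r)
  ball-full = sum-tight (λ k → ball≤ (toℕ k)) (+-cancelˡ-≤ (status c) _ _
    (≤-trans (status-≤ q q*r≤ ≤[1+q]*r) (layers-≥ (suc q))))

  shallow : ∀ w → depth w ≤ suc q
  shallow = layers-≤⇒shallow (suc q)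
    (≤-trans (+-monoʳ-≤ (status c) balls≤full) (status-≤ q q*r≤ ≤[1+q]*r))

  ball-full′ : ∀ {k} → k ≤ q → ball k ≡ suc (k * r)
  ball-full′ {k} k≤q = subst (λ i → ball i ≡ suc (i * r)) (Fin.toℕ-fromℕ< (s≤s k≤q))
    (ball-full (Fin.fromℕ< (s≤s k≤q)))

  level-one : level 1 ≡ r
  level-one = suc-injective (begin
    suc (level 1)     ≡⟨ cong (_+ level 1) ball-zero ⟨
    ball 0 + level 1  ≡⟨ ball-suc 0 ⟨
    ball 1            ≡⟨ ball-full′ 0<q ⟩
    suc (1 * r)       ≡⟨ cong suc (*-identityˡ r) ⟩
    suc r             ∎)
    where open ≡-Reasoning

  level-last : level (suc q) ≡ s
  level-last = +-cancelˡ-≡ (r * q) _ _ (suc-injective (begin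
    suc (r * q) + level (suc q)  ≡⟨ cong (λ x → suc x + level (suc q)) (*-comm r q) ⟩
    suc (q * r) + level (suc q)  ≡⟨ cong (_+ level (suc q)) (ball-full′ ≤-refl) ⟨
    ball q + level (suc q)       ≡⟨ ball-suc q ⟨
    ball (suc q)                 ≡⟨ sum-cong-≗ (λ w → 𝟙-yes (depth w ≤? suc q) (shallow w)) ⟩
    ∑[ w < n ] 1                 ≡⟨ trans (sum-const n 1) (*-identityʳ n) ⟩
    n                            ≡⟨ n≡ ⟩
    suc (r + t)                  ≡⟨ cong suc r*q+s ⟨
    suc (r * q + s)              ∎))
    where open ≡-Reasoning

  -- The values of `low` are `r` at `c`, 2 at the vertices of degree two and 1 elsewhere. They bound
  -- the degrees from below and add up to `n + t + r - 1 = 2 n - 2`, the degree sum, so they are the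
  -- degrees.
  degree-≤2 : ∀ {v} → v ≢ c → degree graph v ≤ 2
  degree-≤2 {v} v≢c = subst (_≤ 2) (sum-tight low≤ degrees≤ v) low≤2
    where
    open ≤-Reasoning
    suc-r∸1 : suc (r ∸ 1) ≡ r
    suc-r∸1 = suc-pred r

    low : Fin n → ℕ
    low v = 1 + 𝟙 (two? v) + (r ∸ 1) * 𝟙 (v Fin.≟ c)

    deg-c : degree graph c ≡ r
    deg-c = trans degree-root level-one

    degree-positive : ∀ {v} → v ≢ c → 1 ≤ degree graph v
    degree-positive {v} v≢c = subst (1 ≤_) (sym (degree≡# v))
      (#-positive (v ~?_) (parent v) (~-sym (proj₁ (parent-down v≢c))))

    low≤ : ∀ v → low v ≤ degree graph v
    low≤ v with v Fin.≟ c
    ... | yes refl = ≤-reflexive (begin-equality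
      1 + 𝟙 (two? c) + (r ∸ 1) * 1
        ≡⟨ cong₂ (λ x y → 1 + x + y)
             (𝟙-no (two? c) (λ eq → 1+n≰n (subst (3 ≤_) (trans (sym deg-c) eq) 3≤r)))
             (*-identityʳ (r ∸ 1)) ⟩
      suc (r ∸ 1)                   ≡⟨ suc-r∸1 ⟩
      r                             ≡⟨ deg-c ⟨
      degree graph c                ∎)
    ... | no v≢c = begin
      1 + 𝟙 (two? v) + (r ∸ 1) * 0
        ≡⟨ trans (cong (1 + 𝟙 (two? v) +_) (*-zeroʳ (r ∸ 1))) (+-identityʳ _) ⟩
      1 + 𝟙 (two? v)                ≤⟨ nonroot (degree graph v) (degree-positive v≢c) ⟩
      degree graph v                ∎
      where
      nonroot : ∀ m → 1 ≤ m → 1 + 𝟙 (m ≟ 2) ≤ m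
      nonroot 1 _ = ≤-refl
      nonroot 2 _ = ≤-refl
      nonroot (suc (suc (suc m))) _ = s≤s z≤n

    low≤2 : low v ≤ 2
    low≤2 = begin
      low v
        ≡⟨ cong (λ x → 1 + 𝟙 (two? v) + (r ∸ 1) * x) (𝟙-no (v Fin.≟ c) v≢c) ⟩
      1 + 𝟙 (two? v) + (r ∸ 1) * 0
        ≡⟨ trans (cong (1 + 𝟙 (two? v) +_) (*-zeroʳ (r ∸ 1))) (+-identityʳ _) ⟩
      1 + 𝟙 (two? v)                      ≤⟨ s≤s (𝟙-mono (two? v) (yes refl) (λ _ → refl {x = v})) ⟩
      2                                   ∎

    degrees≤ : ∑[ v < n ] degree graph v ≤ sum low
    degrees≤ = ≤-reflexive (+-cancelˡ-≡ 2 _ _ (begin-equality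
      2 + ∑[ v < n ] degree graph v       ≡⟨ degree-sum ⟩
      2 * n                               ≡⟨ cong (n +_) (+-identityʳ n) ⟩
      n + n
        ≡⟨ cong (n +_) (trans n≡ (cong (λ x → suc (x + t)) (sym suc-r∸1))) ⟩
      n + suc (suc (r ∸ 1) + t)           ≡⟨ rearrange n t (r ∸ 1) ⟩
      2 + (n + t + (r ∸ 1))               ≡⟨ cong (2 +_) lows ⟨
      2 + sum low                         ∎))
      where
      rearrange : ∀ n t x → n + suc (suc x + t) ≡ 2 + (n + t + x)
      rearrange = solve-∀
      lows : sum low ≡ n + t + (r ∸ 1)
      lows = begin-equality
        sum low
          ≡⟨ ∑-distrib-+ (λ v → 1 + 𝟙 (two? v)) (λ v → (r ∸ 1) * 𝟙 (v Fin.≟ c)) ⟩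
        ∑[ v < n ] (1 + 𝟙 (two? v)) + ∑[ v < n ] ((r ∸ 1) * 𝟙 (v Fin.≟ c))
          ≡⟨ cong₂ _+_ (∑-distrib-+ (λ _ → 1) (𝟙 ∘ two?))
                       (sym (*-distribˡ-sum (r ∸ 1) (λ v → 𝟙 (v Fin.≟ c)))) ⟩
        ∑[ v < n ] 1 + # two? + (r ∸ 1) * # (Fin._≟ c)
          ≡⟨ cong₂ _+_ (cong₂ _+_ (trans (sum-const n 1) (*-identityʳ n)) #two)
                       (trans (cong ((r ∸ 1) *_) (#-singleton c)) (*-identityʳ (r ∸ 1))) ⟩
        n + t + (r ∸ 1) ∎

  -- The legs.

  child-unique : ∀ {u x y} → u ≢ c → Down u x → Down u y → x ≡ y
  child-unique {u} {x} {y} u≢c u↓x u↓y with x Fin.≟ y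
  ... | yes x≡y = x≡y
  ... | no  x≢y = contradiction
    (≤-trans (#-three (u ~?_) (~-sym (proj₁ p↓u)) (proj₁ u↓x) (proj₁ u↓y) (p≢ u↓x) (p≢ u↓y) x≢y)
             (≤-trans (≤-reflexive (sym (degree≡# u))) (degree-≤2 u≢c)))
    1+n≰n
    where
    p↓u : Down (parent u) u
    p↓u = parent-down u≢c
    p≢ : ∀ {z} → Down u z → parent u ≢ z
    p≢ u↓z eq = <-asym (proj₂ u↓z) (subst (λ z → depth z < depth u) eq (proj₂ p↓u))

  -- A leg is represented by its foot, the vertex next to the root.
  leg : Fin n → Fin n
  leg = ancestor 1

  depth-leg : ∀ {w k} → depth w ≡ suc k → depth (leg w) ≡ 1
  depth-leg {w} {k} dw = trans (depth-climb (depth w ∸ 1) w)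
    (trans (cong (λ d → d ∸ (d ∸ 1)) dw) (m+n∸n≡m 1 k))

  climb-parent : ∀ k w → climb k (parent w) ≡ climb (suc k) w
  climb-parent zero    w = refl
  climb-parent (suc k) w = cong parent (climb-parent k w)

  leg-parent : ∀ {w k} → depth w ≡ suc (suc k) → leg (parent w) ≡ leg w
  leg-parent {w} {k} dw = begin
    climb (depth (parent w) ∸ 1) (parent w)
      ≡⟨ cong (λ d → climb (d ∸ 1) (parent w)) (trans (depth-parent w) (cong pred dw)) ⟩
    climb k (parent w)                       ≡⟨ climb-parent k w ⟩
    climb (suc k) w                          ≡⟨ cong (λ d → climb (d ∸ 1) w) dw ⟨
    climb (depth w ∸ 1) w                    ∎
    where open ≡-Reasoning

  -- Steps upwards can be undone by `child-unique` as long as they stop short of the root.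
  climb-injective : ∀ j {w w′} → depth w ≡ depth w′ → j < depth w → climb j w ≡ climb j w′ → w ≡ w′
  climb-injective zero    _ _ eq = eq
  climb-injective (suc j) {w} {w′} dw lt eq =
    climb-injective j dw (<⇒≤ lt)
      (child-unique parent≢c down (subst (λ p → Down p (climb j w′)) (sym eq) down′))
    where
    deep : 0 < depth w ∸ suc j
    deep = m<n⇒0<n∸m lt
    parent≢c : climb (suc j) w ≢ c
    parent≢c eq′ = <-irrefl
      (sym (trans (sym (depth-climb (suc j) w)) (trans (cong depth eq′) (d-refl c)))) deep
    below : ∀ {x} → 0 < depth x ∸ suc j → climb j x ≢ c
    below {x} pos eq′ = n≮0 (subst (0 <_) (trans (sym (pred[m∸n]≡m∸[1+n] (depth x) j))
      (cong pred (trans (sym (depth-climb j x)) (trans (cong depth eq′) (d-refl c))))) pos)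
    down : Down (climb (suc j) w) (climb j w)
    down = parent-down (below deep)
    down′ : Down (climb (suc j) w′) (climb j w′)
    down′ = parent-down (below (subst (λ d → 0 < d ∸ suc j) dw deep))

  -- Depth and leg serve as coordinates; for the root the depth says everything.
  depth-leg-injective : ∀ {w w′} → depth w ≡ depth w′ → (0 < depth w → leg w ≡ leg w′) → w ≡ w′
  depth-leg-injective {w} {w′} dw same with depth w ≟ 0
  ... | yes d≡0 = trans (sym (d≡0⇒≡ d≡0)) (d≡0⇒≡ (trans (sym dw) d≡0))
  ... | no  d≢0 = climb-injective (depth w ∸ 1) dw (∸-monoʳ-< z<s 0<d)
    (trans (same 0<d) (cong (λ d → climb (d ∸ 1) w′) (sym dw)))
    where
    0<d : 0 < depth w
    0<d = n≢0⇒n>0 d≢0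

  Foot : Fin n → Set
  Foot x = depth x ≡ 1

  Long : Fin n → Set
  Long x = ∃[ w ] (depth w ≡ suc q × leg w ≡ x)

  long? : ∀ x → Dec (Long x)
  long? x = any? (λ w → (depth w ≟ suc q) ×-dec (leg w Fin.≟ x))

  -- Sorting the feet by this key puts the long legs first.
  key : Fin n → ℕ
  key x = (if does (long? x) then 0 else n) + toℕ x

  key-long : ∀ {x} → Long x → key x ≡ toℕ x
  key-long {x} long = cong (_+ toℕ x) (if-yes (long? x) long)

  key-short : ∀ {x} → ¬ Long x → key x ≡ n + toℕ x
  key-short {x} ¬long = cong (_+ toℕ x) (if-no (long? x) ¬long)

  key-<⇒long : ∀ {x y} → Long x → key y < key x → Long y
  key-<⇒long {x} {y} long lt = decidable-stable (long? y) λ ¬long → <-asym (Fin.toℕ<n x)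
    (≤-<-trans (m≤m+n n (toℕ y)) (subst₂ _<_ (key-short ¬long) (key-long long) lt))

  key-injective : ∀ {x y} → key x ≡ key y → x ≡ y
  key-injective {x} {y} eq with long? x | long? y
  ... | yes _ | yes _ = Fin.toℕ-injective eq
  ... | yes _ | no  _ =
    contradiction (≤-trans (m≤m+n n (toℕ y)) (≤-reflexive (sym eq))) (<⇒≱ (Fin.toℕ<n x))
  ... | no  _ | yes _ =
    contradiction (≤-trans (m≤m+n n (toℕ x)) (≤-reflexive eq)) (<⇒≱ (Fin.toℕ<n y))
  ... | no  _ | no  _ = Fin.toℕ-injective (+-cancelˡ-≡ n _ _ eq)

  before? : ∀ x y → Dec (Foot y × key y < key x)
  before? x y = (depth y ≟ 1) ×-dec (key y <? key x)

  -- The index of a leg in the sorted order, obtained by counting instead of sorting a list.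
  rank : Fin n → ℕ
  rank x = # (before? x)

  rank<r : ∀ {x} → Foot x → rank x < r
  rank<r {x} foot = subst (rank x <_) level-one
    (#-strict (before? x) (λ y → depth y ≟ 1) (λ _ → proj₁) x foot (λ (_ , lt) → <-irrefl refl lt))

  rank-mono : ∀ {x y} → Foot x → key x < key y → rank x < rank y
  rank-mono {x} {y} foot lt = #-strict (before? x) (before? y)
    (λ z (foot-z , lt-z) → foot-z , <-trans lt-z lt) x (foot , lt) (λ (_ , lt-x) → <-irrefl refl lt-x)

  rank-injective : ∀ {x y} → Foot x → Foot y → rank x ≡ rank y → x ≡ y
  rank-injective {x} {y} fx fy eq with <-cmp (key x) (key y)
  ... | tri< lt _ _ = contradiction eq (<⇒≢ (rank-mono fx lt))
  ... | tri≈ _ same _ = key-injective same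
  ... | tri> _ _ gt = contradiction (sym eq) (<⇒≢ (rank-mono fy gt))

  -- Only long feet precede a long one, and each of them is the leg of a vertex on the last level,
  -- which has `s` vertices.
  rank<s : ∀ {x} → Foot x → Long x → rank x < s
  rank<s {x} foot long = <-≤-trans
    (#-strict (before? x) long? (λ y (_ , lt) → key-<⇒long long lt) x long
      (λ (_ , lt) → <-irrefl refl lt))
    (subst (# long? ≤_) level-last (#-surjection long? (λ w → depth w ≟ suc q) leg (λ _ → id)))

  -- The isomorphism with the spider.

  ℓ : Fin r → ℕ
  ℓ = legLength n r

  ℓ≡ : ∀ i → ℓ i ≡ (if does (toℕ i <? s) then q + 1 else q)
  ℓ≡ i = cong (λ m → if does (toℕ i <? (m ∸ r * (m / r))) then m / r + 1 else m / r) (cong (_∸ 1) n≡)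

  ℓ-long : ∀ {i} → toℕ i < s → ℓ i ≡ suc q
  ℓ-long {i} i<s = trans (ℓ≡ i) (trans (if-yes (toℕ i <? s) i<s) (+-comm q 1))

  ℓ-short : ∀ {i} → ¬ toℕ i < s → ℓ i ≡ q
  ℓ-short {i} i≮s = trans (ℓ≡ i) (if-no (toℕ i <? s) i≮s)

  q≤ℓ : ∀ i → q ≤ ℓ i
  q≤ℓ i with toℕ i <? s
  ... | yes i<s = subst (q ≤_) (sym (ℓ-long i<s)) (n≤1+n q)
  ... | no  i≮s = ≤-reflexive (sym (ℓ-short i≮s))

  legIndex : ∀ {w k} → depth w ≡ suc k → Fin r
  legIndex dw = Fin.fromℕ< (rank<r (depth-leg dw))

  toℕ-legIndex : ∀ {w k} (dw : depth w ≡ suc k) → toℕ (legIndex dw) ≡ rank (leg w)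
  toℕ-legIndex dw = Fin.toℕ-fromℕ< (rank<r (depth-leg dw))

  <ℓ : ∀ {w k} (dw : depth w ≡ suc k) → k < ℓ (legIndex dw)
  <ℓ {w} {k} dw with k ≟ q
  -- A vertex at depth `suc q` makes its leg long, and the long legs have the indices below `s`.
  ... | yes refl = subst (q <_) (sym (ℓ-long (subst (_< s) (sym (toℕ-legIndex dw))
                     (rank<s (depth-leg dw) (w , dw , refl))))) ≤-refl
  ... | no  k≢q  = <-≤-trans (≤∧≢⇒< (s≤s⁻¹ (subst (_≤ suc q) dw (shallow w))) k≢q) (q≤ℓ (legIndex dw))

  -- The depth is a separate argument with an equation so that proofs can match on it.
  place : ∀ w k → depth w ≡ k → SpiderVertex ℓ
  place w zero    _  = centre
  place w (suc k) dw = on (legIndex dw) (Fin.fromℕ< (<ℓ dw))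

  toSpider : Fin n → SpiderVertex ℓ
  toSpider w = place w (depth w) refl

  height : SpiderVertex ℓ → ℕ
  height centre   = 0
  height (on i j) = suc (toℕ j)

  -- The value at the centre is a default, hence the positivity conditions wherever indices are
  -- compared.
  index : SpiderVertex ℓ → ℕ
  index centre   = 0
  index (on i j) = toℕ i

  height-toSpider : ∀ w → height (toSpider w) ≡ depth w
  height-toSpider w = go (depth w) refl
    where
    go : ∀ k (dw : depth w ≡ k) → height (place w k dw) ≡ k
    go zero    _  = refl
    go (suc k) dw = cong suc (Fin.toℕ-fromℕ< (<ℓ dw))

  index-toSpider : ∀ {w} → 0 < depth w → index (toSpider w) ≡ rank (leg w)
  index-toSpider {w} = go (depth w) refl
    where
    go : ∀ k (dw : depth w ≡ k) → 0 < k → index (place w k dw) ≡ rank (leg w)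
    go (suc k) dw _ = toℕ-legIndex dw

  foot : ∀ {w} → 0 < depth w → Foot (leg w)
  foot {w} 0<d = depth-leg (sym (suc-pred (depth w) {{>-nonZero 0<d}}))

  index⇒leg : ∀ {w w′} → 0 < depth w → 0 < depth w′ →
              index (toSpider w) ≡ index (toSpider w′) → leg w ≡ leg w′
  index⇒leg p p′ eq = rank-injective (foot p) (foot p′)
    (trans (sym (index-toSpider p)) (trans eq (index-toSpider p′)))

  toSpider-injective : ∀ {w w′} → toSpider w ≡ toSpider w′ → w ≡ w′
  toSpider-injective {w} {w′} eq = depth-leg-injective dw
    (λ 0<d → index⇒leg 0<d (subst (0 <_) dw 0<d) (cong index eq))
    where
    dw : depth w ≡ depth w′
    dw = trans (sym (height-toSpider w)) (trans (cong height eq) (height-toSpider w′))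

  ◁-intro : ∀ x y → height y ≡ suc (height x) → (0 < height x → index x ≡ index y) → _◁_ ℓ x y
  ◁-intro centre   (on i j) h same = attach (suc-injective h)
  ◁-intro (on i j) (on k l) h same with refl ← Fin.toℕ-injective {i = i} {k} (same z<s) =
    along (suc-injective h)

  ◁-height : ∀ {x y} → _◁_ ℓ x y → height y ≡ suc (height x)
  ◁-height (attach eq) = cong suc eq
  ◁-height (along eq)  = cong suc eq

  ◁-index : ∀ {x y} → _◁_ ℓ x y → 0 < height x → index x ≡ index y
  ◁-index (along _) _ = refl

  down⇒◁ : ∀ {u v} → Down u v → _◁_ ℓ (toSpider u) (toSpider v)
  down⇒◁ {u} {v} u↓v = ◁-intro _ _
    (trans (height-toSpider v) (trans dv (cong suc (sym (height-toSpider u)))))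
    (λ 0<h → let 0<du = subst (0 <_) (height-toSpider u) 0<h in
      trans (index-toSpider 0<du) (trans (cong rank (same 0<du)) (sym (index-toSpider 0<dv))))
    where
    dv : depth v ≡ suc (depth u)
    dv = down-depth u↓v
    0<dv : 0 < depth v
    0<dv = subst (0 <_) (sym dv) z<s
    same : 0 < depth u → leg u ≡ leg v
    same 0<du = trans (cong leg (sym (down⇒parent u↓v)))
      (leg-parent (trans dv (cong suc (sym (suc-pred (depth u) {{>-nonZero 0<du}})))))

  -- The parent of `v` has the coordinates of `u` and is therefore `u`.
  ◁⇒~ : ∀ {u v} → _◁_ ℓ (toSpider u) (toSpider v) → u ~ v
  ◁⇒~ {u} {v} u◁v = subst (_~ v) (sym u≡parent) (proj₁ (parent-down (depth-≢ dv)))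
    where
    dv : depth v ≡ suc (depth u)
    dv = trans (sym (height-toSpider v)) (trans (◁-height u◁v) (cong suc (height-toSpider u)))
    0<dv : 0 < depth v
    0<dv = subst (0 <_) (sym dv) z<s
    u≡parent : u ≡ parent v
    u≡parent = depth-leg-injective (sym (trans (depth-parent v) (cong pred dv))) λ 0<du →
      trans (index⇒leg 0<du 0<dv (◁-index u◁v (subst (0 <_) (sym (height-toSpider u)) 0<du)))
            (sym (leg-parent (trans dv (cong suc (sym (suc-pred (depth u) {{>-nonZero 0<du}}))))))

  -- The labelling of `BalancedSpider`, used here to embed the vertices of `S n r` into `Fin n`.
  number : SpiderVertex ℓ → ℕ
  number centre   = 0
  number (on i j) = suc (toℕ i + toℕ j * r)

  number<n : ∀ x → number x < n
  number<n centre   = subst (0 <_) (sym n≡) z<s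
  number<n (on i j) = subst (number (on i j) <_) (sym n≡) (s≤s (bound (toℕ i <? s)))
    where
    open ≤-Reasoning
    bound : Dec (toℕ i < s) → toℕ i + toℕ j * r < r + t
    bound (yes i<s) = begin-strict
      toℕ i + toℕ j * r  <⟨ +-monoˡ-< (toℕ j * r) i<s ⟩
      s + toℕ j * r
        ≤⟨ +-monoʳ-≤ s (*-monoˡ-≤ r (s≤s⁻¹ (subst (toℕ j <_) (ℓ-long i<s) (Fin.toℕ<n j)))) ⟩
      s + q * r          ≡⟨ trans (+-comm s (q * r)) (cong (_+ s) (*-comm q r)) ⟩
      r * q + s          ≡⟨ r*q+s ⟩
      r + t              ∎
    bound (no i≮s) = begin-strict
      toℕ i + toℕ j * r  <⟨ +-monoˡ-< (toℕ j * r) (Fin.toℕ<n i) ⟩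
      suc (toℕ j) * r    ≤⟨ *-monoˡ-≤ r (subst (toℕ j <_) (ℓ-short i≮s) (Fin.toℕ<n j)) ⟩
      q * r              ≤⟨ q*r≤ ⟩
      r + t              ∎

  number-%r : ∀ i (j : Fin (ℓ i)) → pred (number (on i j)) % r ≡ toℕ i
  number-%r i j = trans ([m+kn]%n≡m%n (toℕ i) (toℕ j) r) (m<n⇒m%n≡m (Fin.toℕ<n i))

  number-injective : ∀ {x y} → number x ≡ number y → x ≡ y
  number-injective {centre} {centre} _ = refl
  number-injective {on i j} {on k l} eq
    with refl ← Fin.toℕ-injective {i = i} {k}
                  (trans (sym (number-%r i j)) (trans (cong (λ m → pred m % r) eq) (number-%r k l))) =
    cong (on i) (Fin.toℕ-injective (*-cancelʳ-≡ (toℕ j) (toℕ l) r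
      (+-cancelˡ-≡ (toℕ i) _ _ (suc-injective eq))))

  fromSpider : SpiderVertex ℓ → Fin n
  fromSpider x = Fin.fromℕ< (number<n x)

  fromSpider-injective : ∀ {x y} → fromSpider x ≡ fromSpider y → x ≡ y
  fromSpider-injective {x} {y} eq = number-injective
    (trans (sym (Fin.toℕ-fromℕ< (number<n x))) (trans (cong toℕ eq) (Fin.toℕ-fromℕ< (number<n y))))

  -- Followed by the injection `fromSpider`, `toSpider` becomes an injective map of `Fin n` to
  -- itself, which is onto.
  toSpider-surjective : ∀ x → ∃[ w ] toSpider w ≡ x
  toSpider-surjective x with w , eq ← injective⇒surjective
    {f = λ w → fromSpider (toSpider w)} (toSpider-injective ∘ fromSpider-injective) (fromSpider x) =
    w , fromSpider-injective eq

  isomorphism : graph ≅ S n r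
  isomorphism = record
    { vertices  = mk↔ₛ′ toSpider (proj₁ ∘ toSpider-surjective) (proj₂ ∘ toSpider-surjective)
                    (λ w → toSpider-injective (proj₂ (toSpider-surjective (toSpider w))))
    ; adjacency = λ u v → mk⇔ (forward u v) (λ { (inj₁ u◁v) → ◁⇒~ u◁v ; (inj₂ v◁u) → ~-sym (◁⇒~ v◁u) })
    }
    where
    forward : ∀ u v → u ~ v → _◁_ ℓ (toSpider u) (toSpider v) ⊎ _◁_ ℓ (toSpider v) (toSpider u)
    forward u v u~v with closer-or-farther c u~v
    ... | inj₁ lt = inj₁ (down⇒◁ (u~v , lt))
    ... | inj₂ gt = inj₂ (down⇒◁ (~-sym u~v , gt))

-- Comparison of a maximal tree with the spider.

-- The equality at the central vertex of `T` is set against the inequality for `T′`, which holds at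
-- any vertex `c′`.
status-minimal : ∀ {n t} (T T′ : 𝓔 n t) → 𝓔.mostar T′ ≤ 𝓔.mostar T → ∀ c c′ →
  (∀ u → Mostar.status (𝓔.graph T) (𝓔.isTree T) c ≤ Mostar.status (𝓔.graph T) (𝓔.isTree T) u) →
  Mostar.status (𝓔.graph T) (𝓔.isTree T) c ≤ Mostar.status (𝓔.graph T′) (𝓔.isTree T′) c′
status-minimal {n} T T′ T′≤T c c′ central = *-cancelˡ-≤ 2 (+-cancelˡ-≤ (𝓔.mostar T) _ _ (begin
  𝓔.mostar T + 2 * T.status c      ≡⟨ T.Rooted.mostar-≡ c central ⟩
  (n ∸ 1) * n                      ≤⟨ T′.Rooted.mostar-≥ c′ ⟩
  𝓔.mostar T′ + 2 * T′.status c′   ≤⟨ +-monoˡ-≤ (2 * T′.status c′) T′≤T ⟩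
  𝓔.mostar T + 2 * T′.status c′    ∎))
  where
  open ≤-Reasoning
  module T  = Mostar (𝓔.graph T) (𝓔.isTree T)
  module T′ = Mostar (𝓔.graph T′) (𝓔.isTree T′)

-- Stated for a variable `r` so that matching on it and on the equation turns `n` into the order of
-- `BalancedSpider`.
maximal⇒spider : ∀ {n t r} .{{_ : NonZero r}} → n ≡ suc (r + t) → 3 ≤ r → (T : 𝓔 n t) →
                 (∀ (T′ : 𝓔 n t) → 𝓔.mostar T′ ≤ 𝓔.mostar T) → 𝓔.graph T ≅ S n r
maximal⇒spider {t = t} {suc (suc (suc r′))} refl 3≤r@(s≤s (s≤s (s≤s _))) T maximal
  with c , central ← Mostar.centre-exists (𝓔.graph T) (𝓔.isTree T) zero =
  Extremal.isomorphism refl 3≤r (𝓔.graph T) (𝓔.isTree T) (𝓔.degreeTwo T) c λ q lower upper →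
    ≤-trans (+-monoˡ-≤ _ (status-minimal T spider∈𝓔 (maximal spider∈𝓔) c zero central))
            (status-≤ q lower upper)
  where open BalancedSpider r′ t using (spider∈𝓔; status-≤)

theorem4p1 : ∀ (n t : ℕ) (t≤n-4 : t + 4 ≤ n) (T : 𝓔 n t) →
    (∀ (T′ : 𝓔 n t) → 𝓔.mostar T′ ≤ 𝓔.mostar T) →
    𝓔.graph T ≅ S n (n ∸ t ∸ 1) {{n∸t∸1-nonZero t≤n-4}}
theorem4p1 n t t≤n-4 = maximal⇒spider {{n∸t∸1-nonZero t≤n-4}} n≡ 3≤r
  where
  open ≡-Reasoning
  t<n : t < n
  t<n = <-≤-trans (m<m+n t z<s) t≤n-4
  n≡ : n ≡ suc (n ∸ t ∸ 1 + t)
  n≡ = sym (begin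
    suc (n ∸ t ∸ 1) + t  ≡⟨ cong (_+ t) (suc-pred (n ∸ t) {{>-nonZero (m<n⇒0<n∸m t<n)}}) ⟩
    n ∸ t + t            ≡⟨ m∸n+n≡m (<⇒≤ t<n) ⟩
    n                    ∎)
  3≤r : 3 ≤ n ∸ t ∸ 1
  3≤r = s≤s⁻¹ (+-cancelʳ-≤ t 4 _ (subst₂ _≤_ (+-comm t 4) n≡ t≤n-4))
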